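{- For every integer $k\geq 2$, the limit $\lim_{n\to\infty}|\mathcal H_n^k(321)|^{1/n}$ exists and $$\lim_{n\to\infty}|\mathcal H_n^k(321)|^{1/n}=4.$$
   Context: A permutation $\sigma=\sigma_1\cdots\sigma_n$ of $[n]=\{1,\ldots,n\}$ avoids $321$ if there are no indices $a<b<c$ with $\sigma_a>\sigma_b>\sigma_c$. A complete $k$-ary tree is a rooted tree in which every vertex not in the penultimate or last level has exactly $k$ children and all vertices in the last level are as far left as possible. Equivalently, if $v_1,\ldots,v_n$ are the vertices in breadth-first order (starting from the root, level by level, each level from left to right), then the children of $v_i$ are those $v_j$ with $k(i-1)+2\le j\le ki+1$ and $j\le n$. For each $n$ there is exactly one complete $k$-ary tree with $n$ vertices. An $n$-vertex $k$-ary heap is a bijective labeling of the vertices of this tree by $[n]$ such that each vertex has a label smaller than the labels of its children. The permutation associated to a $k$-ary heap is the permutation obtained by reading the labels of $v_1,v_2,\ldots,v_n$ in this order. $\mathcal H_n^k(321)$ is the set of $n$-vertex $k$-ary heaps whose associated permutations avoid $321$. -}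

module Defs where

open import Algebra.Definitions.RawSemiring using ()
open import Data.Empty using (⊥)
open import Data.Fin.Base as Fin using (Fin; toℕ)
import Data.Fin.Properties as Fin
import Data.Integer.Base as ℤ
open import Data.List.Base using (List; []; _∷_; length; filter; allFin; cartesianProductWith)
open import Data.List.Membership.Propositional using (_∈_)
open import Data.List.Membership.Propositional.Properties using (∈-cartesianProductWith⁺; ∈-allFin)
open import Data.List.Relation.Unary.Any using (here)
open import Data.List.Relation.Unary.All as All using ()
open import Data.List.Relation.Unary.AllPairs as AllPairs using ()
open import Data.List.Relation.Unary.Unique.Propositional using (Unique)
import Data.List.Relation.Unary.Unique.Propositional.Properties as Unique
open import Data.Nat.Base as ℕ using (ℕ; zero; suc; NonZero)
import Data.Nat.Properties as ℕ
open import Data.Product.Base using (∃; ∃-syntax; _×_; _,_; proj₁; proj₂)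
open import Data.Rational.Base
  using (ℚ; 0ℚ; 1ℚ; _/_; _+_; _*_; _-_; -_; 1/_; _<_; _≤_;
         Positive; NonNegative; positive; nonNegative; +-*-rawSemiring)
import Data.Rational.Base as ℚ
import Data.Rational.Properties as ℚ
open import Data.Rational.Solver using (module +-*-Solver)
open import Data.Sum.Base using (_⊎_; inj₁; inj₂)
open import Data.Vec.Base as Vec using (Vec; lookup)
open import Data.Vec.Properties using (∷-injective)
open import Function.Definitions using (Injective; Surjective; Bijective)
open import Relation.Binary.PropositionalEquality
  using (_≡_; refl; sym; trans; cong; subst)
open import Relation.Nullary using (¬_; Dec; yes; no; contradiction)
open import Relation.Nullary.Decidable using (map′; ¬?; _×-dec_; _→-dec_)

-- A word σ₁⋯σₙ.  Positions and letters are elements of Fin n, i.e. the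
-- order-isomorphic copy {0,…,n-1} of [n].
Word : ℕ → Set
Word n = Vec (Fin n) n

IsPermutation : ∀ {n} → Word n → Set
IsPermutation σ = Bijective _≡_ _≡_ (lookup σ)

Avoids321 : ∀ {n} → Word n → Set
Avoids321 σ = ¬ (∃[ a ] ∃[ b ] ∃[ c ]
  (a Fin.< b × b Fin.< c × lookup σ b Fin.< lookup σ a × lookup σ c Fin.< lookup σ b))

-- 1-based breadth-first index of a vertex: pos i = t means that i is vₜ.
pos : ∀ {n} → Fin n → ℕ
pos i = suc (toℕ i)

-- Child k i j: in the complete k-ary tree on n vertices, j is a child of i.
-- The bound pos j ≤ n is built into j : Fin n.
Child : ∀ (k : ℕ) {n} → Fin n → Fin n → Set
Child k i j = (k ℕ.* (pos i ℕ.∸ 1) ℕ.+ 2 ℕ.≤ pos j) × (pos j ℕ.≤ k ℕ.* pos i ℕ.+ 1)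

-- A heap is identified with its word of labels read in breadth-first order.
IsHeap : ∀ (k : ℕ) {n} → Word n → Set
IsHeap k σ = IsPermutation σ ×
  (∀ i j → Child k i j → lookup σ i Fin.< lookup σ j)

IsHeap321 : ∀ (k : ℕ) {n} → Word n → Set
IsHeap321 k σ = IsHeap k σ × Avoids321 σ

injective? : ∀ {m n} (f : Fin m → Fin n) → Dec (Injective _≡_ _≡_ f)
injective? f = map′ (λ inj {x} {y} → inj x y) (λ inj x y → inj {x} {y})
  (Fin.all? λ x → Fin.all? λ y → (f x Fin.≟ f y) →-dec (x Fin.≟ y))

surjective? : ∀ {m n} (f : Fin m → Fin n) → Dec (Surjective _≡_ _≡_ f)
surjective? f = map′
  (λ sur y → proj₁ (sur y) , λ { refl → proj₂ (sur y) })
  (λ sur y → proj₁ (sur y) , proj₂ (sur y) refl)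
  (Fin.all? λ y → Fin.any? λ x → f x Fin.≟ y)

isPermutation? : ∀ {n} (σ : Word n) → Dec (IsPermutation σ)
isPermutation? σ = injective? (lookup σ) ×-dec surjective? (lookup σ)

avoids321? : ∀ {n} (σ : Word n) → Dec (Avoids321 σ)
avoids321? σ = ¬? (Fin.any? λ a → Fin.any? λ b → Fin.any? λ c →
  (a Fin.<? b) ×-dec (b Fin.<? c) ×-dec
  (lookup σ b Fin.<? lookup σ a) ×-dec (lookup σ c Fin.<? lookup σ b))

child? : ∀ k {n} (i j : Fin n) → Dec (Child k i j)
child? k i j = (_ ℕ.≤? _) ×-dec (_ ℕ.≤? _)

isHeap? : ∀ k {n} (σ : Word n) → Dec (IsHeap k σ)
isHeap? k σ = isPermutation? σ ×-dec
  (Fin.all? λ i → Fin.all? λ j → child? k i j →-dec (lookup σ i Fin.<? lookup σ j))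

isHeap321? : ∀ k {n} (σ : Word n) → Dec (IsHeap321 k σ)
isHeap321? k σ = isHeap? k σ ×-dec avoids321? σ

allVecs : ∀ n m → List (Vec (Fin n) m)
allVecs n zero    = Vec.[] ∷ []
allVecs n (suc m) = cartesianProductWith Vec._∷_ (allFin n) (allVecs n m)

∈-allVecs : ∀ {n m} (v : Vec (Fin n) m) → v ∈ allVecs n m
∈-allVecs Vec.[]       = here refl
∈-allVecs (x Vec.∷ xs) = ∈-cartesianProductWith⁺ Vec._∷_ (∈-allFin x) (∈-allVecs xs)

allVecs-unique : ∀ n m → Unique (allVecs n m)
allVecs-unique n zero    = All.[] AllPairs.∷ AllPairs.[]
allVecs-unique n (suc m) =
  Unique.cartesianProductWith⁺ Vec._∷_ ∷-injective (Unique.allFin⁺ n) (allVecs-unique n m)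

-- ∣𝓗ₙᵏ(321)∣; by ∈-allVecs and allVecs-unique the list below has each
-- element of 𝓗ₙᵏ(321) exactly once.
∣𝓗321∣ : (k n : ℕ) → ℕ
∣𝓗321∣ k n = length (filter (isHeap321? k) (allVecs n n))

-- Two-sided Dedekind cuts of ℚ.
record ℝ : Set₁ where
  field
    L U         : ℚ → Set     -- L q is "q < x", U q is "x < q"
    L-inhabited : ∃ L
    U-inhabited : ∃ U
    L-lower     : ∀ {q r} → q < r → L r → L q
    U-upper     : ∀ {q r} → q < r → U q → U r
    L-open      : ∀ {q} → L q → ∃[ r ] (q < r × L r)
    U-open      : ∀ {r} → U r → ∃[ q ] (q < r × U q)
    disjoint    : ∀ {q} → L q → U q → ⊥
    located     : ∀ {q r} → q < r → L q ⊎ U r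

open ℝ public

fromℚ : ℚ → ℝ
fromℚ p = record
  { L           = _< p
  ; U           = p <_
  ; L-inhabited = p - 1ℚ , p-1<p
  ; U-inhabited = p + 1ℚ , p<p+1
  ; L-lower     = ℚ.<-trans
  ; U-upper     = λ q<r p<q → ℚ.<-trans p<q q<r
  ; L-open      = λ q<p → let (r , q<r , r<p) = ℚ.<-dense q<p in r , q<r , r<p
  ; U-open      = λ p<r → let (q , p<q , q<r) = ℚ.<-dense p<r in q , q<r , p<q
  ; disjoint    = ℚ.<-asym
  ; located     = loc
  }
  where
  p-1<p : p - 1ℚ < p
  p-1<p = subst (p - 1ℚ <_) (ℚ.+-identityʳ p) (ℚ.+-monoʳ-< p (ℚ.negative⁻¹ (- 1ℚ)))
  p<p+1 : p < p + 1ℚ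
  p<p+1 = subst (_< p + 1ℚ) (ℚ.+-identityʳ p) (ℚ.+-monoʳ-< p (ℚ.positive⁻¹ 1ℚ))
  loc : ∀ {q r} → q < r → (q < p) ⊎ (p < r)
  loc {q} q<r with q ℚ.<? p
  ... | yes q<p = inj₁ q<p
  ... | no  q≮p = inj₂ (ℚ.≤-<-trans (ℚ.≮⇒≥ q≮p) q<r)

-- x < y + ε: some rational q has x < q and q - ε < y.
LessUpTo : ℚ → ℝ → ℝ → Set
LessUpTo ε x y = ∃[ q ] (U x q × L y (q - ε))

-- ∣ x - y ∣ < ε
Within : ℚ → ℝ → ℝ → Set
Within ε x y = LessUpTo ε x y × LessUpTo ε y x

-- Convergence of a sequence indexed by the positive integers.
infix 4 _⟶_
_⟶_ : ((n : ℕ) .{{_ : NonZero n}} → ℝ) → ℝ → Set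
x ⟶ ℓ = ∀ (ε : ℚ) → 0ℚ < ε →
  ∃[ N ] (∀ n .{{_ : NonZero n}} → N ℕ.≤ n → Within ε (x n) ℓ)

open Algebra.Definitions.RawSemiring +-*-rawSemiring public using (_^_)

fromℕ : ℕ → ℚ
fromℕ a = ℤ.+ a / 1

private
  open +-*-Solver using (solve; con; _:+_; _:*_; _:-_; _:=_)

  0<1 : 0ℚ < 1ℚ
  0<1 = ℚ.positive⁻¹ 1ℚ

  0≤fromℕ : ∀ a → 0ℚ ≤ fromℕ a
  0≤fromℕ a = ℚ.nonNegative⁻¹ (fromℕ a) {{ℚ.normalize-nonNeg a 1}}

  *-mono : ∀ {a b c d} → 0ℚ ≤ a → 0ℚ ≤ d → a ≤ b → c ≤ d → a * c ≤ b * d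
  *-mono {a} {b} {c} {d} 0≤a 0≤d a≤b c≤d = ℚ.≤-trans
    (ℚ.*-monoˡ-≤-nonNeg a {{nonNegative 0≤a}} c≤d)
    (ℚ.*-monoʳ-≤-nonNeg d {{nonNegative 0≤d}} a≤b)

  *-nonNeg : ∀ {a b} → 0ℚ ≤ a → 0ℚ ≤ b → 0ℚ ≤ a * b
  *-nonNeg {a} {b} 0≤a 0≤b =
    subst (_≤ a * b) (ℚ.*-zeroˡ 0ℚ) (*-mono ℚ.≤-refl 0≤b 0≤a 0≤b)

  +-nonNeg : ∀ {a b} → 0ℚ ≤ a → 0ℚ ≤ b → 0ℚ ≤ a + b
  +-nonNeg 0≤a 0≤b = ℚ.+-mono-≤ 0≤a 0≤b

  *-pos : ∀ {a b} → 0ℚ < a → 0ℚ < b → 0ℚ < a * b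
  *-pos {a} {b} 0<a 0<b = subst (_< a * b) (ℚ.*-zeroʳ a)
    (ℚ.*-monoʳ-<-pos a {{positive 0<a}} 0<b)

  <⇒0<- : ∀ {a b} → a < b → 0ℚ < b - a
  <⇒0<- {a} {b} a<b = subst (_< b - a) (ℚ.+-inverseʳ a) (ℚ.+-monoˡ-< (- a) a<b)

  ^-nonNeg : ∀ {x} n → 0ℚ ≤ x → 0ℚ ≤ x ^ n
  ^-nonNeg zero    0≤x = ℚ.<⇒≤ 0<1
  ^-nonNeg (suc n) 0≤x = *-nonNeg 0≤x (^-nonNeg n 0≤x)

  ^-mono : ∀ {x y} n → 0ℚ ≤ x → x ≤ y → x ^ n ≤ y ^ n
  ^-mono zero    0≤x x≤y = ℚ.≤-refl
  ^-mono (suc n) 0≤x x≤y =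
    *-mono 0≤x (^-nonNeg n (ℚ.≤-trans 0≤x x≤y)) x≤y (^-mono n 0≤x x≤y)

  ^-pos : ∀ {x} n → 0ℚ < x → 0ℚ < x ^ n
  ^-pos zero    0<x = 0<1
  ^-pos (suc n) 0<x = *-pos 0<x (^-pos n 0<x)

  ^-mono-< : ∀ {x y} n .{{_ : NonZero n}} → 0ℚ ≤ x → x < y → x ^ n < y ^ n
  ^-mono-< {x} {y} (suc n) 0≤x x<y = ℚ.≤-<-trans
    (ℚ.*-monoˡ-≤-nonNeg x {{nonNegative 0≤x}} (^-mono n 0≤x (ℚ.<⇒≤ x<y)))
    (ℚ.*-monoˡ-<-pos (y ^ n) {{positive (^-pos n (ℚ.≤-<-trans 0≤x x<y))}} x<y)

  1≤^ : ∀ {x} n → 1ℚ ≤ x → 1ℚ ≤ x ^ n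
  1≤^ zero        1≤x = ℚ.≤-refl
  1≤^ {x} (suc n) 1≤x = *-mono (ℚ.<⇒≤ 0<1) (^-nonNeg n (ℚ.≤-trans (ℚ.<⇒≤ 0<1) 1≤x))
    1≤x (1≤^ n 1≤x)

  x≤x^ : ∀ {x} n .{{_ : NonZero n}} → 1ℚ ≤ x → x ≤ x ^ n
  x≤x^ {x} (suc n) 1≤x = subst (_≤ x * x ^ n) (ℚ.*-identityʳ x)
    (ℚ.*-monoˡ-≤-nonNeg x {{nonNegative (ℚ.≤-trans (ℚ.<⇒≤ 0<1) 1≤x)}} (1≤^ n 1≤x))

  -- A Lipschitz constant for x ↦ xⁿ on [0, M].
  lip : ℕ → ℚ → ℚ
  lip zero    M = 0ℚ
  lip (suc n) M = M ^ n + M * lip n M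

  lip-nonNeg : ∀ {M} n → 0ℚ ≤ M → 0ℚ ≤ lip n M
  lip-nonNeg zero    0≤M = ℚ.≤-refl
  lip-nonNeg (suc n) 0≤M = +-nonNeg (^-nonNeg n 0≤M) (*-nonNeg 0≤M (lip-nonNeg n 0≤M))

  ^-lip : ∀ {x d M} n → 0ℚ ≤ x → 0ℚ ≤ d → x + d ≤ M →
          (x + d) ^ n ≤ x ^ n + lip n M * d
  ^-lip {x} {d} {M} zero 0≤x 0≤d y≤M = ℚ.≤-reflexive
    (sym (trans (cong (1ℚ +_) (ℚ.*-zeroˡ d)) (ℚ.+-identityʳ 1ℚ)))
  ^-lip {x} {d} {M} (suc n) 0≤x 0≤d y≤M = begin
    (x + d) * (x + d) ^ n
      ≤⟨ ℚ.*-monoˡ-≤-nonNeg (x + d) {{nonNegative 0≤y}} (^-lip n 0≤x 0≤d y≤M) ⟩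
    (x + d) * (x ^ n + K * d)
      ≡⟨ solve 4 (λ x d p K → (x :+ d) :* (p :+ K :* d)
                    := x :* p :+ (p :* d :+ (x :+ d) :* (K :* d)))
               refl x d (x ^ n) K ⟩
    x * x ^ n + (x ^ n * d + (x + d) * (K * d))
      ≤⟨ ℚ.+-monoʳ-≤ (x * x ^ n) (ℚ.+-mono-≤
           (ℚ.*-monoʳ-≤-nonNeg d {{nonNegative 0≤d}} (^-mono n 0≤x x≤M))
           (ℚ.*-monoʳ-≤-nonNeg (K * d)
             {{nonNegative (*-nonNeg (lip-nonNeg n 0≤M) 0≤d)}} y≤M)) ⟩
    x * x ^ n + (M ^ n * d + M * (K * d))
      ≡⟨ solve 5 (λ s m d M K → s :+ (m :* d :+ M :* (K :* d))
                    := s :+ (m :+ M :* K) :* d)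
               refl (x * x ^ n) (M ^ n) d M K ⟩
    x * x ^ n + (M ^ n + M * K) * d ∎
    where
    open ℚ.≤-Reasoning
    K = lip n M
    0≤y : 0ℚ ≤ x + d
    0≤y = +-nonNeg 0≤x 0≤d
    0≤M : 0ℚ ≤ M
    0≤M = ℚ.≤-trans 0≤y y≤M
    x≤M : x ≤ M
    x≤M = ℚ.≤-trans (subst (_≤ x + d) (ℚ.+-identityʳ x) (ℚ.+-monoʳ-≤ x 0≤d)) y≤M

  small : ∀ {g K} → 0ℚ < g → 0ℚ ≤ K → ∃[ δ ] (0ℚ < δ × δ < 1ℚ × K * δ < g)
  small {g} {K} 0<g 0≤K = δ , 0<δ , δ<1 , Kδ<g
    where
    D = g + (K + 1ℚ)
    0<K+1 : 0ℚ < K + 1ℚ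
    0<K+1 = ℚ.+-mono-≤-< 0≤K 0<1
    K<D : K < D
    K<D = subst (_< D) (trans (ℚ.+-identityˡ (K + 0ℚ)) (ℚ.+-identityʳ K))
      (ℚ.+-mono-< 0<g (ℚ.+-monoʳ-< K 0<1))
    g<D : g < D
    g<D = subst (_< D) (ℚ.+-identityʳ g) (ℚ.+-monoʳ-< g 0<K+1)
    instance
      D-pos : Positive D
      D-pos = positive (ℚ.<-trans 0<g g<D)
      D-nonZero : ℚ.NonZero D
      D-nonZero = ℚ.pos⇒nonZero D
      D-nonNeg : NonNegative D
      D-nonNeg = ℚ.pos⇒nonNeg D
    δ = g * 1/ D
    δD≡g : δ * D ≡ g
    δD≡g = trans (ℚ.*-assoc g (1/ D) D)
      (trans (cong (g *_) (ℚ.*-inverseˡ D)) (ℚ.*-identityʳ g))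
    0<δ : 0ℚ < δ
    0<δ = *-pos 0<g (ℚ.positive⁻¹ (1/ D) {{ℚ.1/pos⇒pos D}})
    δ<1 : δ < 1ℚ
    δ<1 = ℚ.*-cancelʳ-<-nonNeg D
      (subst (_< 1ℚ * D) (sym δD≡g) (subst (g <_) (sym (ℚ.*-identityˡ D)) g<D))
    Kδ<g : K * δ < g
    Kδ<g = subst (K * δ <_) (trans (ℚ.*-comm D δ) δD≡g)
      (ℚ.*-monoˡ-<-pos δ {{positive 0<δ}} K<D)

  ^-open-above : ∀ {q a} n → 0ℚ ≤ q → q ^ n < a → ∃[ r ] (q < r × r ^ n < a)
  ^-open-above {q} {a} n 0≤q qⁿ<a = q + δ , q<r , rⁿ<a
    where
    K = lip n (q + 1ℚ)
    s = small {K = K} (<⇒0<- qⁿ<a) (lip-nonNeg n (+-nonNeg 0≤q (ℚ.<⇒≤ 0<1)))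
    δ = proj₁ s
    0<δ : 0ℚ < δ
    0<δ = proj₁ (proj₂ s)
    q<r : q < q + δ
    q<r = subst (_< q + δ) (ℚ.+-identityʳ q) (ℚ.+-monoʳ-< q 0<δ)
    rⁿ<a : (q + δ) ^ n < a
    rⁿ<a = ℚ.≤-<-trans
      (^-lip n 0≤q (ℚ.<⇒≤ 0<δ) (ℚ.+-monoʳ-≤ q (ℚ.<⇒≤ (proj₁ (proj₂ (proj₂ s))))))
      (subst (q ^ n + K * δ <_)
        (solve 2 (λ p a → p :+ (a :- p) := a) refl (q ^ n) a)
        (ℚ.+-monoʳ-< (q ^ n) (proj₂ (proj₂ (proj₂ s)))))

  ^-open-below : ∀ {q a} n → 0ℚ < q → a < q ^ n → ∃[ r ] (r < q × 0ℚ < r × a < r ^ n)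
  ^-open-below {q} {a} n 0<q a<qⁿ = r , r<q , 0<r , a<rⁿ
    where
    K = lip n q
    0≤q = ℚ.<⇒≤ 0<q
    s = small {K = K * q} (<⇒0<- a<qⁿ) (*-nonNeg (lip-nonNeg n 0≤q) 0≤q)
    δ = proj₁ s
    0<δ : 0ℚ < δ
    0<δ = proj₁ (proj₂ s)
    r = q * (1ℚ - δ)
    0<r : 0ℚ < r
    0<r = *-pos 0<q (<⇒0<- (proj₁ (proj₂ (proj₂ s))))
    r+qδ≡q : r + q * δ ≡ q
    r+qδ≡q = solve 2 (λ q d → q :* (con 1ℚ :- d) :+ q :* d := q) refl q δ
    0<qδ : 0ℚ < q * δ
    0<qδ = *-pos 0<q 0<δ
    r<q : r < q
    r<q = subst (r <_) r+qδ≡q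
      (subst (_< r + q * δ) (ℚ.+-identityʳ r) (ℚ.+-monoʳ-< r 0<qδ))
    qⁿ≤ : q ^ n ≤ r ^ n + K * (q * δ)
    qⁿ≤ = subst (λ y → y ^ n ≤ r ^ n + K * (q * δ)) r+qδ≡q
      (^-lip n (ℚ.<⇒≤ 0<r) (ℚ.<⇒≤ 0<qδ) (ℚ.≤-reflexive r+qδ≡q))
    qⁿ<rⁿ+g : q ^ n < r ^ n + (q ^ n - a)
    qⁿ<rⁿ+g = ℚ.≤-<-trans qⁿ≤ (ℚ.+-monoʳ-< (r ^ n)
      (subst (_< q ^ n - a) (ℚ.*-assoc K q δ) (proj₂ (proj₂ (proj₂ s)))))
    a<rⁿ : a < r ^ n
    a<rⁿ = subst (_< r ^ n) (solve 2 (λ p a → p :+ (a :- p) := a) refl (q ^ n) a)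
      (subst (q ^ n + (a - q ^ n) <_)
        (solve 3 (λ p t a → t :+ (p :- a) :+ (a :- p) := t) refl (q ^ n) (r ^ n) a)
        (ℚ.+-monoˡ-< (a - q ^ n) qⁿ<rⁿ+g))

-- The nonnegative real a^(1/n).  Negative q are put in the lower cut
-- separately, since q ^ n < a can fail for them when n is even.
root : (n : ℕ) .{{_ : NonZero n}} → ℕ → ℝ
root n a = record
  { L           = λ q → (q < 0ℚ) ⊎ (q ^ n < fromℕ a)
  ; U           = λ q → 0ℚ < q × fromℕ a < q ^ n
  ; L-inhabited = - 1ℚ , inj₁ (ℚ.negative⁻¹ (- 1ℚ))
  ; U-inhabited = a+1 , ℚ.<-≤-trans 0<1 1≤a+1 , ℚ.<-≤-trans a<a+1 (x≤x^ n 1≤a+1)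
  ; L-lower     = lower
  ; U-upper     = λ { q<r (0<q , a<qⁿ) →
                    ℚ.<-trans 0<q q<r ,
                    ℚ.<-trans a<qⁿ (^-mono-< n (ℚ.<⇒≤ 0<q) q<r) }
  ; L-open      = opn
  ; U-open      = λ { (0<q , a<qⁿ) → ^-open-below n 0<q a<qⁿ }
  ; disjoint    = λ { (inj₁ q<0)  (0<q , _)    → ℚ.<-asym q<0 0<q
                    ; (inj₂ qⁿ<a) (_   , a<qⁿ) → ℚ.<-asym qⁿ<a a<qⁿ }
  ; located     = loc
  }
  where
  a+1 = fromℕ a + 1ℚ
  a<a+1 : fromℕ a < a+1
  a<a+1 = subst (_< a+1) (ℚ.+-identityʳ (fromℕ a)) (ℚ.+-monoʳ-< (fromℕ a) 0<1)
  1≤a+1 : 1ℚ ≤ a+1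
  1≤a+1 = subst (_≤ a+1) (ℚ.+-identityˡ 1ℚ) (ℚ.+-monoˡ-≤ 1ℚ (0≤fromℕ a))
  lower : ∀ {q r} → q < r → (r < 0ℚ) ⊎ (r ^ n < fromℕ a) → (q < 0ℚ) ⊎ (q ^ n < fromℕ a)
  lower q<r (inj₁ r<0) = inj₁ (ℚ.<-trans q<r r<0)
  lower {q} q<r (inj₂ rⁿ<a) with q ℚ.<? 0ℚ
  ... | yes q<0 = inj₁ q<0
  ... | no  q≮0 = inj₂ (ℚ.<-trans (^-mono-< n (ℚ.≮⇒≥ q≮0) q<r) rⁿ<a)
  opn : ∀ {q} → (q < 0ℚ) ⊎ (q ^ n < fromℕ a) →
        ∃[ r ] (q < r × ((r < 0ℚ) ⊎ (r ^ n < fromℕ a)))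
  opn {q} l with q ℚ.<? 0ℚ
  ... | yes q<0 = let (r , q<r , r<0) = ℚ.<-dense q<0 in r , q<r , inj₁ r<0
  opn {q} (inj₁ q<0)  | no q≮0 = contradiction q<0 q≮0
  opn {q} (inj₂ qⁿ<a) | no q≮0 =
    let (r , q<r , rⁿ<a) = ^-open-above n (ℚ.≮⇒≥ q≮0) qⁿ<a in r , q<r , inj₂ rⁿ<a
  loc : ∀ {q r} → q < r →
        ((q < 0ℚ) ⊎ (q ^ n < fromℕ a)) ⊎ (0ℚ < r × fromℕ a < r ^ n)
  loc {q} {r} q<r with q ℚ.<? 0ℚ | (q ^ n) ℚ.<? fromℕ a
  ... | yes q<0 | _        = inj₁ (inj₁ q<0)
  ... | no  _   | yes qⁿ<a = inj₁ (inj₂ qⁿ<a)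
  ... | no  q≮0 | no  qⁿ≮a = inj₂
    ( ℚ.≤-<-trans (ℚ.≮⇒≥ q≮0) q<r
    , ℚ.≤-<-trans (ℚ.≮⇒≥ qⁿ≮a) (^-mono-< n (ℚ.≮⇒≥ q≮0) q<r) )

{-# OPTIONS --safe #-}

-- Upper bound: a 321-avoiding permutation is determined by its first letter v
-- and the pattern τ of the rest, where the letters of τ below v must increase;
-- this recursion counts them by ballot numbers, so there are at most 4ⁿ.
-- Lower bound: if m ≤ n + 1, the direct sum of a heap on n vertices and any
-- 321-avoiding permutation of length m is again a heap, because the last m
-- vertices have no children.  Hence h(n + m) ≥ h(n) Cₘ with Cₘ the Catalan
-- number, and for a fixed large m this gives growth at least Cₘ^(1/m), which
-- tends to 4 since Cₘ (m + 1)² ≥ 4ᵐ.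
module Submission where

open import Defs renaming (_^_ to _^ℚ_)
open import Algebra.Bundles using (CommutativeRing)
import Algebra.Properties.CommutativeSemiring.Exp as Exp
open import Data.Fin.Base as Fin using (Fin; zero; suc; toℕ; punchIn; punchOut; _↑ˡ_; _↑ʳ_)
import Data.Fin.Properties as Fin
import Data.Integer.Base as ℤ
import Data.Integer.Properties as ℤ
open import Data.List.Base as List
  using (List; []; _∷_; _++_; length; filter; cartesianProductWith)
open import Data.List.Membership.Propositional using (_∈_)
open import Data.List.Membership.Propositional.Properties
  using (∈-map⁺; ∈-map⁻; ∈-++⁺ˡ; ∈-++⁺ʳ; ∈-++⁻; ∈-∃++; ∈-filter⁺; ∈-filter⁻;
         ∈-cartesianProductWith⁻)
import Data.List.Properties as List
open import Data.List.Relation.Binary.Permutation.Propositional.Properties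
  using (shift; ↭-length; ∈-resp-↭)
open import Data.List.Relation.Unary.All as All using ()
open import Data.List.Relation.Unary.AllPairs as AllPairs using ()
open import Data.List.Relation.Unary.Any using (here; there)
open import Data.List.Relation.Unary.Unique.Propositional using (Unique)
import Data.List.Relation.Unary.Unique.Propositional.Properties as Unique
open import Data.Nat.Base as ℕ
  using (ℕ; zero; suc; _+_; _*_; _^_; _!; _∸_; _≤_; _<_; z≤n; s≤s; NonZero)
open import Data.Nat.Coprimality as Coprime using (1-coprimeTo)
open import Data.Nat.DivMod
  using (_/_; _%_; _mod_; m≡m%n+[m/n]*n; m%n<n; m<n⇒m%n≡m; /-monoˡ-≤; m*n/n≡m)
import Data.Nat.Properties as ℕ
open import Data.Nat.Tactic.RingSolver using (solve-∀)
open import Data.Product.Base using (∃-syntax; _×_; _,_; proj₁; proj₂)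
open import Data.Rational.Base as ℚ using (ℚ; mkℚ; 0ℚ; 1ℚ)
import Data.Rational.Properties as ℚ
open import Data.Rational.Solver using (module +-*-Solver)
open import Data.Sum.Base using (inj₁; inj₂)
open import Data.Vec.Base as Vec using ([]; _∷_; lookup)
import Data.Vec.Properties as Vec
open import Function.Base using (_∘_)
open import Function.Definitions using (Injective; Surjective)
open import Relation.Binary.PropositionalEquality
open import Relation.Nullary using (¬_; yes; no; contradiction)

open Exp (CommutativeRing.commutativeSemiring ℚ.+-*-commutativeRing) using (^-distrib-*)

-- Ballot and Catalan numbers

-- Nonnegative lattice paths with steps +1 and -1 from height `s` to 0 that have `d` up-steps; from
-- height 0 the next step has to go up.
ballot : ℕ → ℕ → ℕ
ballot zero    s       = 1
ballot (suc d) zero    = ballot d 1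
ballot (suc d) (suc s) = ballot (suc d) s + ballot d (2 + s)

-- Such a path has 2d + s steps, with at most two choices for each.
ballot-≤ : ∀ d s → ballot d s ≤ 2 ^ (d + d + s)
ballot-≤ zero    s       = ℕ.m^n>0 2 s
ballot-≤ (suc d) zero    = ℕ.≤-trans (ballot-≤ d 1)
  (ℕ.^-monoʳ-≤ 2 (ℕ.≤-trans (ℕ.n≤1+n _) (ℕ.≤-reflexive (exponent d))))
  where
  exponent : ∀ d → suc (d + d + 1) ≡ suc d + suc d + 0
  exponent = solve-∀
ballot-≤ (suc d) (suc s) = begin
  ballot (suc d) s + ballot d (2 + s)               ≤⟨ ℕ.+-mono-≤ (ballot-≤ (suc d) s) (ballot-≤ d (2 + s)) ⟩
  2 ^ (suc d + suc d + s) + 2 ^ (d + d + (2 + s))   ≡⟨ cong₂ (λ x y → 2 ^ x + 2 ^ y) (e₁ d s) (e₂ d s) ⟩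
  2 ^ q + 2 ^ q                                     ≡⟨ cong (2 ^ q +_) (ℕ.+-identityʳ (2 ^ q)) ⟨
  2 ^ suc q                                         ≡⟨ cong (2 ^_) (e₃ d s) ⟩
  2 ^ (suc d + suc d + suc s)                       ∎
  where
  open ℕ.≤-Reasoning
  q = 2 + (d + d + s)
  e₁ : ∀ d s → suc d + suc d + s ≡ 2 + (d + d + s)
  e₁ = solve-∀
  e₂ : ∀ d s → d + d + (2 + s) ≡ 2 + (d + d + s)
  e₂ = solve-∀
  e₃ : ∀ d s → suc (2 + (d + d + s)) ≡ suc d + suc d + suc s
  e₃ = solve-∀

-- The ballot formula (s+1)/(d+s+1) * binom(2d+s, d), cleared of denominators.
ballot-closed : ∀ d s → ballot d s * (d ! * (suc (d + s)) !) ≡ suc s * (d + d + s) !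
ballot-closed zero    s = trans (ℕ.*-identityˡ _) (ℕ.*-identityˡ _)
ballot-closed (suc d) zero = begin
  b * ((suc d * d !) * (2 + (d + 0)) !) ≡⟨ cong (λ x → b * ((suc d * d !) * x !)) (e₁ d) ⟩
  b * ((suc d * d !) * p !)             ≡⟨ e₂ b d (d !) (p !) ⟩
  suc d * (b * (d ! * p !))             ≡⟨ cong (suc d *_) (ballot-closed d 1) ⟩
  suc d * (2 * (d + d + 1) !)           ≡⟨ e₃ d ((d + d + 1) !) ⟩
  1 * (suc (d + d + 1)) !               ≡⟨ cong (λ x → 1 * x !) (e₄ d) ⟩
  1 * (suc d + suc d + 0) !             ∎
  where
  open ≡-Reasoning
  b = ballot d 1
  p = suc (d + 1)
  e₁ : ∀ d → 2 + (d + 0) ≡ suc (d + 1)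
  e₁ = solve-∀
  e₂ : ∀ b d f g → b * ((suc d * f) * g) ≡ suc d * (b * (f * g))
  e₂ = solve-∀
  e₃ : ∀ d h → suc d * (2 * h) ≡ 1 * (suc (d + d + 1) * h)
  e₃ = solve-∀
  e₄ : ∀ d → suc (d + d + 1) ≡ suc d + suc d + 0
  e₄ = solve-∀
ballot-closed (suc d) (suc s) = begin
  (b₁ + b₂) * ((suc d * d !) * (suc (suc d + suc s)) !)
    ≡⟨ cong (λ x → (b₁ + b₂) * ((suc d * d !) * x !)) (e₁ d s) ⟩
  (b₁ + b₂) * ((suc d * d !) * (suc p * p !))
    ≡⟨ e₂ b₁ b₂ d (d !) (suc p) (p !) ⟩
  suc p * (b₁ * ((suc d * d !) * p !)) + suc d * (b₂ * (d ! * (suc p) !))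
    ≡⟨ cong₂ (λ x y → suc p * x + suc d * y) (ballot-closed (suc d) s)
         (trans (cong (λ x → b₂ * (d ! * x !)) (sym (e₃ d s))) (ballot-closed d (2 + s))) ⟩
  suc p * (suc s * (suc d + suc d + s) !) + suc d * ((3 + s) * (d + d + (2 + s)) !)
    ≡⟨ cong (λ x → suc p * (suc s * (suc d + suc d + s) !) + suc d * ((3 + s) * x !)) (e₄ d s) ⟩
  suc p * (suc s * q !) + suc d * ((3 + s) * q !)
    -- The factorial (2d+s+2)! is now common, and (d+s+3)(s+1) + (d+1)(s+3) = (s+2)(2d+s+3) remains.
    ≡⟨ e₅ d s (q !) ⟩
  (2 + s) * (suc q * q !)
    ≡⟨ cong (λ x → (2 + s) * x !) (e₆ d s) ⟩
  (2 + s) * (suc d + suc d + suc s) ! ∎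
  where
  open ≡-Reasoning
  b₁ = ballot (suc d) s
  b₂ = ballot d (2 + s)
  p = suc (suc d + s)
  q = suc d + suc d + s
  e₁ : ∀ d s → 1 + (suc d + suc s) ≡ suc (suc (suc d + s))
  e₁ = solve-∀
  e₂ : ∀ b₁ b₂ d f p g → (b₁ + b₂) * ((suc d * f) * (p * g)) ≡
       p * (b₁ * ((suc d * f) * g)) + suc d * (b₂ * (f * (p * g)))
  e₂ = solve-∀
  e₃ : ∀ d s → 1 + (d + (2 + s)) ≡ suc (suc (suc d + s))
  e₃ = solve-∀
  e₄ : ∀ d s → d + d + (2 + s) ≡ suc d + suc d + s
  e₄ = solve-∀
  e₅ : ∀ d s h → suc (suc (suc d + s)) * (suc s * h) + suc d * ((3 + s) * h) ≡
       (2 + s) * (suc (suc d + suc d + s) * h)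
  e₅ = solve-∀
  e₆ : ∀ d s → suc (suc d + suc d + s) ≡ suc d + suc d + suc s
  e₆ = solve-∀

catalan : ℕ → ℕ
catalan n = ballot n 0

catalan-≤ : ∀ n → catalan n ≤ 4 ^ n
catalan-≤ n = subst (catalan n ≤_)
  (trans (cong (2 ^_) (e n)) (sym (ℕ.^-*-assoc 2 2 n))) (ballot-≤ n 0)
  where
  e : ∀ n → n + n + 0 ≡ 2 * n
  e = solve-∀

-- Quotient of consecutive closed forms at `s = 0`, after cancelling the common factorials.
catalan-suc : ∀ n → catalan (suc n) * (2 + n) ≡ catalan n * (2 * (n + n + 1))
catalan-suc n = ℕ.*-cancelʳ-≡ _ _ (suc n * (n ! * (suc n) !)) {{nz}} (begin
  c′ * (2 + n) * (suc n * (f * g))           ≡⟨ e₁ c′ n f g ⟩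
  -- Reading the factorial as (x - 1)! lets one rewriting of x change the factor and the factorial
  -- together.
  c′ * ((suc n * f) * ((2 + n) * g))         ≡⟨ cong (λ x → c′ * ((suc n * f) * (x * (x ∸ 1) !))) (e₂ n) ⟩
  c′ * ((suc n) ! * (suc (suc n + 0)) !)     ≡⟨ ballot-closed (suc n) 0 ⟩
  1 * (suc n + suc n + 0) !                  ≡⟨ cong (λ x → 1 * x !) (e₃ n) ⟩
  1 * ((2 + (n + n)) * ((1 + (n + n)) * (n + n) !))
                                             ≡⟨ e₄ n ((n + n) !) ⟩
  2 * (n + n + 1) * (suc n * (1 * (n + n) !))
                                             ≡⟨ cong (λ x → 2 * (n + n + 1) * (suc n * (1 * x !))) (e₅ n) ⟩
  2 * (n + n + 1) * (suc n * (1 * (n + n + 0) !))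
                                             ≡⟨ cong (λ x → 2 * (n + n + 1) * (suc n * x)) (ballot-closed n 0) ⟨
  2 * (n + n + 1) * (suc n * (c * (f * (suc (n + 0)) !)))
                                             ≡⟨ cong (λ x → 2 * (n + n + 1) * (suc n * (c * (f * (suc x) !)))) (ℕ.+-identityʳ n) ⟩
  2 * (n + n + 1) * (suc n * (c * (f * g)))  ≡⟨ e₆ c n f g ⟩
  c * (2 * (n + n + 1)) * (suc n * (f * g))  ∎)
  where
  open ≡-Reasoning
  c′ = catalan (suc n)
  c  = catalan n
  f  = n !
  g  = (suc n) !
  nz : NonZero (suc n * (f * g))
  nz = ℕ.m*n≢0 (suc n) (f * g) {{_}} {{ℕ.m*n≢0 f g {{n ℕ.!≢0}} {{suc n ℕ.!≢0}}}}
  e₁ : ∀ c n f g → c * (2 + n) * (suc n * (f * g)) ≡ c * ((suc n * f) * ((2 + n) * g))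
  e₁ = solve-∀
  e₂ : ∀ n → 2 + n ≡ suc (suc n + 0)
  e₂ = solve-∀
  e₃ : ∀ n → suc n + suc n + 0 ≡ 2 + (n + n)
  e₃ = solve-∀
  e₄ : ∀ n h → 1 * ((2 + (n + n)) * ((1 + (n + n)) * h)) ≡ 2 * (n + n + 1) * (suc n * (1 * h))
  e₄ = solve-∀
  e₅ : ∀ n → n + n ≡ n + n + 0
  e₅ = solve-∀
  e₆ : ∀ c n f g → 2 * (n + n + 1) * (suc n * (c * (f * g))) ≡ c * (2 * (n + n + 1)) * (suc n * (f * g))
  e₆ = solve-∀

-- The loss (n+1)² does not affect growth rates and lets the induction close: with the ratio
-- `catalan-suc` it needs only 4(n+1)² ≤ 2(2n+1)(n+2), which has slack 2n.
4^≤catalan : ∀ n → 4 ^ n ≤ catalan n * (suc n * suc n)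
4^≤catalan zero    = ℕ.≤-refl
4^≤catalan (suc n) = begin
  4 * 4 ^ n                                    ≤⟨ ℕ.*-monoʳ-≤ 4 (4^≤catalan n) ⟩
  4 * (c * (suc n * suc n))                    ≤⟨ ℕ.m≤m+n _ (2 * n * c) ⟩
  4 * (c * (suc n * suc n)) + 2 * n * c        ≡⟨ e₁ n c ⟩
  c * (2 * (n + n + 1)) * (2 + n)              ≡⟨ cong (_* (2 + n)) (catalan-suc n) ⟨
  catalan (suc n) * (2 + n) * (2 + n)          ≡⟨ ℕ.*-assoc (catalan (suc n)) (2 + n) (2 + n) ⟩
  catalan (suc n) * ((2 + n) * (2 + n))        ∎
  where
  open ℕ.≤-Reasoning
  c = catalan n
  e₁ : ∀ n c → 4 * (c * (suc n * suc n)) + 2 * n * c ≡ c * (2 * (n + n + 1)) * (2 + n)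
  e₁ = solve-∀

-- Exponential growth against polynomial factors

-- Bernoulli's inequality (1 + 1/a)^k ≥ 1 + k/a, multiplied by a^(k+1) to stay in the natural
-- numbers.
bernoulli : ∀ a k → a ^ k * (a + k) ≤ a * suc a ^ k
bernoulli a zero    = ℕ.≤-reflexive (e a)
  where
  e : ∀ a → 1 * (a + 0) ≡ a * 1
  e = solve-∀
bernoulli a (suc k) = begin
  a * a ^ k * (a + suc k)                    ≤⟨ ℕ.m≤m+n _ (a ^ k * k) ⟩
  a * a ^ k * (a + suc k) + a ^ k * k        ≡⟨ e₁ a k (a ^ k) ⟩
  suc a * (a ^ k * (a + k))                  ≤⟨ ℕ.*-monoʳ-≤ (suc a) (bernoulli a k) ⟩
  suc a * (a * suc a ^ k)                    ≡⟨ e₂ a (suc a ^ k) ⟩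
  a * (suc a * suc a ^ k)                    ∎
  where
  open ℕ.≤-Reasoning
  e₁ : ∀ a k x → a * x * (a + suc k) + x * k ≡ suc a * (x * (a + k))
  e₁ = solve-∀
  e₂ : ∀ a y → suc a * (a * y) ≡ a * (suc a * y)
  e₂ = solve-∀

2*a^a≤[1+a]^a : ∀ a .{{_ : NonZero a}} → 2 * a ^ a ≤ suc a ^ a
2*a^a≤[1+a]^a a = ℕ.*-cancelˡ-≤ a (subst (_≤ a * suc a ^ a) (e a (a ^ a)) (bernoulli a a))
  where
  e : ∀ a x → x * (a + a) ≡ a * (2 * x)
  e = solve-∀

n<2^n : ∀ n → n < 2 ^ n
n<2^n zero    = s≤s z≤n
n<2^n (suc n) = ℕ.+-mono-≤ (ℕ.m^n>0 2 n) (subst (suc n ≤_) (sym (ℕ.+-identityʳ (2 ^ n))) (n<2^n n))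

^-distribʳ-* : ∀ x y n → (x * y) ^ n ≡ x ^ n * y ^ n
^-distribʳ-* x y zero    = refl
^-distribʳ-* x y (suc n) = trans (cong (x * y *_) (^-distribʳ-* x y n)) (e x y (x ^ n) (y ^ n))
  where
  e : ∀ x y u v → x * y * (u * v) ≡ x * u * (y * v)
  e = solve-∀

-- By `2*a^a≤[1+a]^a`, each further `a` in the exponent m at least doubles (1 + 1/a)^m, so enough
-- doublings overcome the quadratic factor.
exponential-beats-square : ∀ a .{{_ : NonZero a}} →
  ∃[ m ] (NonZero m × 2 * a ^ m * (suc m * suc m) ≤ suc a ^ m)
exponential-beats-square a = a * j , ℕ.m*n≢0 a j , (begin
  2 * a ^ m * (suc m * suc m)           ≡⟨ e₁ (a ^ m) (suc m * suc m) ⟩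
  2 * (suc m * suc m) * a ^ m           ≤⟨ ℕ.*-monoˡ-≤ (a ^ m) (ℕ.*-monoʳ-≤ 2 (ℕ.*-mono-≤ m<r⁴ m<r⁴)) ⟩
  2 * ((r * r) * (r * r)) * a ^ m       ≡⟨ cong (_* a ^ m) 2^j ⟨
  2 ^ j * a ^ m                         ≡⟨ cong (2 ^ j *_) (ℕ.^-*-assoc a a j) ⟨
  2 ^ j * (a ^ a) ^ j                   ≡⟨ ^-distribʳ-* 2 (a ^ a) j ⟨
  (2 * a ^ a) ^ j                       ≤⟨ ℕ.^-monoˡ-≤ j (2*a^a≤[1+a]^a a) ⟩
  (suc a ^ a) ^ j                       ≡⟨ ℕ.^-*-assoc (suc a) a j ⟩
  suc a ^ m                             ∎)
  where
  open ℕ.≤-Reasoning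
  -- With r = 2^(4a) this gives 2^j = 2r⁴, while m + 1 ≤ (4a + 1)² ≤ r²; hence 2^j dominates 2(m +
  -- 1)².
  j = suc (4 * a + 4 * a + (4 * a + 4 * a))
  m = a * j
  r = 2 ^ (4 * a)
  e₁ : ∀ x y → 2 * x * y ≡ 2 * y * x
  e₁ = solve-∀
  e₂ : ∀ a → suc (a * suc (4 * a + 4 * a + (4 * a + 4 * a))) + 7 * a ≡ suc (4 * a) * suc (4 * a)
  e₂ = solve-∀
  m<r⁴ : suc m ≤ r * r
  m<r⁴ = ℕ.≤-trans (ℕ.m+n≤o⇒m≤o (suc m) (ℕ.≤-reflexive (e₂ a)))
    (ℕ.*-mono-≤ (n<2^n (4 * a)) (n<2^n (4 * a)))
  2^j : 2 ^ j ≡ 2 * ((r * r) * (r * r))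
  2^j = cong (2 *_) (trans (ℕ.^-distribˡ-+-* 2 (4 * a + 4 * a) (4 * a + 4 * a))
    (cong₂ _*_ (ℕ.^-distribˡ-+-* 2 (4 * a) (4 * a)) (ℕ.^-distribˡ-+-* 2 (4 * a) (4 * a))))

-- Growth of a sequence supermultiplicative against Catalan numbers

module _ (h : ℕ → ℕ) (h0 : 1 ≤ h 0)
         (h-super : ∀ {n m} → m ≤ suc n → h n * catalan m ≤ h (n + m)) where

  h-positive : ∀ n → 1 ≤ h n
  h-positive zero    = h0
  h-positive (suc n) = begin
    1                  ≤⟨ h-positive n ⟩
    h n                ≡⟨ ℕ.*-identityʳ (h n) ⟨
    h n * catalan 1    ≤⟨ h-super (s≤s z≤n) ⟩
    h (n + 1)          ≡⟨ cong h (ℕ.+-comm n 1) ⟩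
    h (suc n)          ∎
    where open ℕ.≤-Reasoning

  -- Blocks of length m are appended one at a time to a base of length r; m ≤ r keeps the length
  -- condition of `h-super` satisfied at each stage.
  catalan^≤h : ∀ {r m} → m ≤ r → ∀ t → catalan m ^ t ≤ h (r + t * m)
  catalan^≤h {r} {m} m≤r zero    = h-positive (r + 0)
  catalan^≤h {r} {m} m≤r (suc t) = begin
    catalan m * catalan m ^ t       ≡⟨ ℕ.*-comm (catalan m) _ ⟩
    catalan m ^ t * catalan m       ≤⟨ ℕ.*-monoˡ-≤ (catalan m) (catalan^≤h m≤r t) ⟩
    h (r + t * m) * catalan m       ≤⟨ h-super (ℕ.m≤n⇒m≤1+n (ℕ.≤-trans m≤r (ℕ.m≤m+n r _))) ⟩
    h (r + t * m + m)               ≡⟨ cong h (e r (t * m) m) ⟩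
    h (r + (m + t * m))             ∎
    where
    open ℕ.≤-Reasoning
    e : ∀ x y z → x + y + z ≡ x + (z + y)
    e = solve-∀

  module _ (a D m : ℕ) .{{_ : NonZero a}} .{{_ : NonZero D}} .{{_ : NonZero m}}
           (2a^m≤c*D^m : 2 * a ^ m ≤ catalan m * D ^ m) where

    open ℕ.≤-Reasoning

    -- Each of the t blocks gains a factor 2 over (a/D)^m, and the total gain 2^t outweighs the
    -- leftover a^r, since a^r ≤ a^(2m) ≤ t < 2^t.
    growth-split : ∀ {r t} → m ≤ r → r ≤ m + m → a ^ (m + m) ≤ t →
                   a ^ (r + t * m) < D ^ (r + t * m) * h (r + t * m)
    growth-split {r} {t} m≤r r≤2m K≤t = begin-strict
      a ^ (r + t * m)                          ≡⟨ ℕ.^-distribˡ-+-* a r (t * m) ⟩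
      a ^ r * a ^ (t * m)                      <⟨ ℕ.*-monoˡ-< (a ^ (t * m)) {{ℕ.m^n≢0 a (t * m)}} a^r<2^t ⟩
      2 ^ t * a ^ (t * m)                      ≡⟨ cong (2 ^ t *_) (^-*-comm a) ⟩
      2 ^ t * (a ^ m) ^ t                      ≡⟨ ^-distribʳ-* 2 (a ^ m) t ⟨
      (2 * a ^ m) ^ t                          ≤⟨ ℕ.^-monoˡ-≤ t 2a^m≤c*D^m ⟩
      (catalan m * D ^ m) ^ t                  ≡⟨ ^-distribʳ-* (catalan m) (D ^ m) t ⟩
      catalan m ^ t * (D ^ m) ^ t              ≡⟨ cong (catalan m ^ t *_) (^-*-comm D) ⟨
      catalan m ^ t * D ^ (t * m)              ≡⟨ ℕ.*-comm (catalan m ^ t) _ ⟩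
      D ^ (t * m) * catalan m ^ t              ≤⟨ ℕ.*-mono-≤ (ℕ.^-monoʳ-≤ D (ℕ.m≤n+m (t * m) r)) (catalan^≤h m≤r t) ⟩
      D ^ (r + t * m) * h (r + t * m)          ∎
      where
      ^-*-comm : ∀ x → x ^ (t * m) ≡ (x ^ m) ^ t
      ^-*-comm x = trans (cong (x ^_) (ℕ.*-comm t m)) (sym (ℕ.^-*-assoc x m t))
      a^r<2^t : a ^ r < 2 ^ t
      a^r<2^t = ℕ.≤-<-trans (ℕ.^-monoʳ-≤ a r≤2m) (ℕ.≤-<-trans K≤t (n<2^n t))

    -- Dividing n - m, rather than n, by m puts the base r = m + remainder between m and 2m; the
    -- bound on n makes the quotient reach a^(2m).
    growth-from : ∀ n → m + a ^ (m + m) * m ≤ n → a ^ n < D ^ n * h n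
    growth-from n N≤n = subst (λ x → a ^ x < D ^ x * h x) (sym n≡)
      (growth-split (ℕ.m≤m+n m _) (ℕ.+-monoʳ-≤ m (ℕ.<⇒≤ (m%n<n l m))) K≤t)
      where
      K = a ^ (m + m)
      l = n ∸ m
      t = l / m
      n≡ : n ≡ m + l % m + t * m
      n≡ = trans (sym (ℕ.m+[n∸m]≡n (ℕ.m+n≤o⇒m≤o m N≤n)))
        (trans (cong (m +_) (m≡m%n+[m/n]*n l m)) (sym (ℕ.+-assoc m _ _)))
      K≤t : K ≤ t
      K≤t = subst (_≤ t) (m*n/n≡m K m)
        (/-monoˡ-≤ m (ℕ.m+n≤o⇒m≤o∸n (K * m) (subst (_≤ n) (ℕ.+-comm m (K * m)) N≤n)))

  -- Here a/D = 4 - 1/D. With m from `exponential-beats-square`, the factor ((a+1)/a)^m pays both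
  -- for the 2 and for the loss (m+1)² in the Catalan bound.
  growth : ∀ a D .{{_ : NonZero a}} .{{_ : NonZero D}} → suc a ≡ 4 * D →
           ∃[ N ] (∀ n → N ≤ n → a ^ n < D ^ n * h n)
  growth a D {{a≢0}} {{D≢0}} 1+a≡4D =
    let (m , m≢0 , beats) = exponential-beats-square a
    in _ , growth-from a D m {{a≢0}} {{D≢0}} {{m≢0}} (large-ratio m beats)
    where
    open ℕ.≤-Reasoning
    large-ratio : ∀ m → 2 * a ^ m * (suc m * suc m) ≤ suc a ^ m → 2 * a ^ m ≤ catalan m * D ^ m
    large-ratio m beats = ℕ.*-cancelʳ-≤ _ _ (suc m * suc m) (begin
      2 * a ^ m * (suc m * suc m)           ≤⟨ beats ⟩
      suc a ^ m                             ≡⟨ cong (_^ m) 1+a≡4D ⟩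
      (4 * D) ^ m                           ≡⟨ ^-distribʳ-* 4 D m ⟩
      4 ^ m * D ^ m                         ≤⟨ ℕ.*-monoˡ-≤ (D ^ m) (4^≤catalan m) ⟩
      catalan m * (suc m * suc m) * D ^ m   ≡⟨ ℕ.*-assoc (catalan m) _ _ ⟩
      catalan m * ((suc m * suc m) * D ^ m) ≡⟨ cong (catalan m *_) (ℕ.*-comm _ (D ^ m)) ⟩
      catalan m * (D ^ m * (suc m * suc m)) ≡⟨ ℕ.*-assoc (catalan m) _ _ ⟨
      catalan m * D ^ m * (suc m * suc m)   ∎)

-- The first-letter decomposition

private variable
  n : ℕ

punchIn-mono-< : ∀ (v : Fin (suc n)) {x y} → x Fin.< y → punchIn v x Fin.< punchIn v y
punchIn-mono-< v {x} {y} x<y = ℕ.≰⇒> λ p → ℕ.<⇒≱ x<y (Fin.punchIn-cancel-≤ v y x p)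

punchIn-cancel-< : ∀ (v : Fin (suc n)) {x y} → punchIn v x Fin.< punchIn v y → x Fin.< y
punchIn-cancel-< v {x} {y} p = ℕ.≰⇒> λ q → ℕ.<⇒≱ p (Fin.punchIn-mono-≤ v y x q)

punchIn<⁻ : ∀ (v : Fin (suc n)) {x} → punchIn v x Fin.< v → x Fin.< v
punchIn<⁻ (suc v) {zero}  _       = s≤s z≤n
punchIn<⁻ (suc v) {suc x} (s≤s p) = s≤s (punchIn<⁻ v p)

punchIn<⁺ : ∀ (v : Fin (suc n)) {x} → x Fin.< v → punchIn v x Fin.< v
punchIn<⁺ (suc v) {zero}  _       = s≤s z≤n
punchIn<⁺ (suc v) {suc x} (s≤s p) = s≤s (punchIn<⁺ v p)

insert : Fin (suc n) → Word n → Word (suc n)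
insert v τ = v ∷ Vec.map (punchIn v) τ

lookup-insert : ∀ (v : Fin (suc n)) (τ : Word n) i →
                lookup (insert v τ) (suc i) ≡ punchIn v (lookup τ i)
lookup-insert v τ i = Vec.lookup-map i (punchIn v) τ

-- After a first letter v, two letters below v in decreasing order would complete a 321; this
-- records the resulting constraint. Bounding the larger letter bounds both.
IncreasingBelow : ℕ → Word n → Set
IncreasingBelow s σ = ∀ i j →
  lookup σ i Fin.< lookup σ j → toℕ (lookup σ j) < s → i Fin.< j

-- The class that removal of the first letter preserves, with a changed `s`. At `s = 0` the third
-- condition is vacuous and all 321-avoiding permutations remain.
Good : ℕ → Word n → Set
Good s σ = IsPermutation σ × Avoids321 σ × IncreasingBelow s σ

map-injective : ∀ {A B : Set} {f : A → B} → Injective _≡_ _≡_ f →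
                Injective _≡_ _≡_ (Vec.map {n = n} f)
map-injective inj {[]}     {[]}     _  = refl
map-injective inj {x ∷ xs} {y ∷ ys} eq =
  cong₂ _∷_ (inj (Vec.∷-injectiveˡ eq)) (map-injective inj (Vec.∷-injectiveʳ eq))

insert-injectiveʳ : ∀ (v : Fin (suc n)) {σ τ} → insert v σ ≡ insert v τ → σ ≡ τ
insert-injectiveʳ v eq =
  map-injective (λ {x} {y} → Fin.punchIn-injective v x y) (Vec.∷-injectiveʳ eq)

insert-permutation : ∀ (v : Fin (suc n)) {τ} → IsPermutation τ → IsPermutation (insert v τ)
insert-permutation {n} v {τ} (inj , sur) = inj′ , sur′
  where
  inj′ : Injective _≡_ _≡_ (lookup (insert v τ))
  inj′ {zero}  {zero}  _ = refl
  inj′ {zero}  {suc j} e = contradiction (trans (sym (lookup-insert v τ j)) (sym e)) (Fin.punchInᵢ≢i v _)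
  inj′ {suc i} {zero}  e = contradiction (trans (sym (lookup-insert v τ i)) e) (Fin.punchInᵢ≢i v _)
  inj′ {suc i} {suc j} e = cong suc (inj (Fin.punchIn-injective v _ _
    (trans (sym (lookup-insert v τ i)) (trans e (lookup-insert v τ j)))))
  sur′ : Surjective _≡_ _≡_ (lookup (insert v τ))
  sur′ y with v Fin.≟ y
  ... | yes v≡y = zero , λ { refl → v≡y }
  ... | no  v≢y = let (x , hx) = sur (punchOut v≢y) in suc x , λ { refl →
    trans (lookup-insert v τ x) (trans (cong (punchIn v) (hx refl)) (Fin.punchIn-punchOut v≢y)) }

insert-permutation⁻ : ∀ (v : Fin (suc n)) {τ} → IsPermutation (insert v τ) → IsPermutation τ
insert-permutation⁻ {n} v {τ} (inj , sur) = inj′ , sur′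
  where
  inj′ : Injective _≡_ _≡_ (lookup τ)
  inj′ {i} {j} e = Fin.suc-injective (inj (trans (lookup-insert v τ i)
    (trans (cong (punchIn v) e) (sym (lookup-insert v τ j)))))
  sur′ : Surjective _≡_ _≡_ (lookup τ)
  sur′ y with sur (punchIn v y)
  ... | zero  , h = contradiction (sym (h refl)) (Fin.punchInᵢ≢i v y)
  ... | suc x , h = x , λ { refl →
    Fin.punchIn-injective v _ _ (trans (sym (lookup-insert v τ x)) (h refl)) }

insert-cancel-< : ∀ (v : Fin (suc n)) (τ : Word n) {i j} →
  lookup (insert v τ) (suc i) Fin.< lookup (insert v τ) (suc j) → lookup τ i Fin.< lookup τ j
insert-cancel-< v τ {i} {j} p =
  punchIn-cancel-< v (subst₂ Fin._<_ (lookup-insert v τ i) (lookup-insert v τ j) p)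

insert-mono-< : ∀ (v : Fin (suc n)) (τ : Word n) {i j} →
  lookup τ i Fin.< lookup τ j → lookup (insert v τ) (suc i) Fin.< lookup (insert v τ) (suc j)
insert-mono-< v τ {i} {j} p =
  subst₂ Fin._<_ (sym (lookup-insert v τ i)) (sym (lookup-insert v τ j)) (punchIn-mono-< v p)

-- A 321 starting at v would have its last two letters decreasing below v; any other one lies
-- entirely in τ.
insert-avoids : ∀ (v : Fin (suc n)) {τ} →
  Avoids321 τ → IncreasingBelow (toℕ v) τ → Avoids321 (insert v τ)
insert-avoids v {τ} av inc (zero , suc b , suc c , _ , s≤s b<c , vb , bc) =
  ℕ.<-asym b<c (inc c b (insert-cancel-< v τ bc)
    (punchIn<⁻ v (subst (Fin._< v) (lookup-insert v τ b) vb)))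
insert-avoids v {τ} av inc (suc a , suc b , suc c , s≤s a<b , s≤s b<c , ab , bc) =
  av (a , b , c , a<b , b<c , insert-cancel-< v τ ab , insert-cancel-< v τ bc)

insert-avoids⁻ : ∀ (v : Fin (suc n)) {τ} →
  Avoids321 (insert v τ) → Avoids321 τ × IncreasingBelow (toℕ v) τ
insert-avoids⁻ v {τ} av =
  (λ (a , b , c , a<b , b<c , ab , bc) → av (suc a , suc b , suc c , s≤s a<b , s≤s b<c ,
    insert-mono-< v τ ab , insert-mono-< v τ bc)) ,
  inc
  where
  inc : IncreasingBelow (toℕ v) τ
  -- Letters of τ below v in the wrong order, preceded by v, form a 321.
  inc i j i<j j<v = ℕ.≰⇒> λ j≤i → av
    ( zero , suc j , suc i , s≤s z≤n
    , s≤s (ℕ.≤∧≢⇒< j≤i λ j≡i → ℕ.<-irrefl (cong (toℕ ∘ lookup τ) (sym (Fin.toℕ-injective j≡i))) i<j)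
    , subst (Fin._< v) (sym (lookup-insert v τ j)) (punchIn<⁺ v j<v)
    , insert-mono-< v τ i<j)

insert-increasing : ∀ (v : Fin (suc n)) {τ} →
  IncreasingBelow (toℕ v) τ → IncreasingBelow (toℕ v) (insert v τ)
insert-increasing v {τ} inc i       zero    _ q = contradiction q (ℕ.<-irrefl refl)
insert-increasing v {τ} inc zero    (suc j) _ q = s≤s z≤n
insert-increasing v {τ} inc (suc i) (suc j) p q = s≤s (inc i j (insert-cancel-< v τ p)
  (punchIn<⁻ v (subst (Fin._< v) (lookup-insert v τ j) q)))

-- The new letter 0 precedes everything and every other letter rises by one, hence the shift of the
-- threshold.
insert-zero-increasing : ∀ {s} {τ : Word n} →
  IncreasingBelow s τ → IncreasingBelow (suc s) (insert zero τ)
insert-zero-increasing {τ = τ} inc i       zero    () _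
insert-zero-increasing {τ = τ} inc zero    (suc j) _  _ = s≤s z≤n
insert-zero-increasing {s = s} {τ = τ} inc (suc i) (suc j) p q = s≤s (inc i j
  (insert-cancel-< zero τ p)
  (ℕ.s<s⁻¹ (subst (λ x → toℕ x < suc s) (lookup-insert zero τ j) q)))

insert-zero-increasing⁻ : ∀ {s} {τ : Word n} →
  IncreasingBelow (suc s) (insert zero τ) → IncreasingBelow s τ
insert-zero-increasing⁻ {s = s} {τ} inc i j p q = ℕ.s<s⁻¹ (inc (suc i) (suc j)
  (insert-mono-< zero τ p)
  (subst (λ x → toℕ x < suc s) (sym (lookup-insert zero τ j)) (s≤s q)))

increasingBelow-anti : ∀ {s t} {σ : Word n} → s ≤ t → IncreasingBelow t σ → IncreasingBelow s σ
increasingBelow-anti s≤t inc i j p q = inc i j p (ℕ.<-≤-trans q s≤t)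

-- A letter v with 0 < v < s cannot come first, since the letter 0 must precede it.
data Decomposition (s : ℕ) : Word (suc n) → Set where
  large : ∀ (v : Fin (suc n)) {τ} → Good (toℕ v) τ → s ≤ toℕ v → Decomposition s (insert v τ)
  least : ∀ {s′} {τ : Word n} → s ≡ suc s′ → Good s′ τ → Decomposition s (insert zero τ)

-- For v ≥ s, increase below v implies increase below s; a leading 0 instead raises the threshold by
-- one.
decompose⁻ : ∀ {s} {σ : Word (suc n)} → Decomposition s σ → Good s σ
decompose⁻ (large v {τ} (perm , av , inc) s≤v) =
  insert-permutation v perm , insert-avoids v av inc ,
  increasingBelow-anti {σ = insert v τ} s≤v (insert-increasing v {τ} inc)
decompose⁻ (least {τ = τ} refl (perm , av , inc)) =
  insert-permutation zero perm ,
  insert-avoids zero av (increasingBelow-anti {σ = τ} z≤n inc) ,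
  insert-zero-increasing inc

decompose : ∀ {s} {σ : Word (suc n)} → Good s σ → Decomposition s σ
decompose {n} {s} {v ∷ ρ} good@((inj , _) , _) = subst (Decomposition s) insert≡
  (analyse s (subst (Good s) (sym insert≡) good))
  where
  v≢ : ∀ i → v ≢ lookup ρ i
  v≢ i e with () ← inj {zero} {suc i} e
  -- Injectivity keeps v out of the rest, so deleting v from the alphabet recovers τ.
  τ : Word n
  τ = Vec.tabulate (λ i → punchOut (v≢ i))
  insert≡ : insert v τ ≡ v ∷ ρ
  insert≡ = cong (v ∷_) (trans (sym (Vec.tabulate-∘ (punchIn v) _))
    (trans (Vec.tabulate-cong (λ i → Fin.punchIn-punchOut (v≢ i))) (Vec.tabulate∘lookup ρ)))
  analyse : ∀ s {v τ} → Good s (insert v τ) → Decomposition s (insert v τ)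
  analyse s {v} {τ} (perm , av , inc) with s ℕ.≤? toℕ v
  ... | yes s≤v = large v (insert-permutation⁻ v perm , insert-avoids⁻ v av) s≤v
  analyse zero {v} _ | no s≰v = contradiction z≤n s≰v
  analyse (suc s) {zero} (perm , av , inc) | no _ = least refl
    (insert-permutation⁻ zero perm , proj₁ (insert-avoids⁻ zero av) , insert-zero-increasing⁻ inc)
  analyse (suc s) {suc v} (perm , av , inc) | no s≰v with proj₂ perm zero
  ... | x , h with () ← inc x zero (subst (Fin._< suc v) (sym (h refl)) (s≤s z≤n)) (ℕ.≰⇒> s≰v)

-- For n = d + s, members d s lists the σ with Good s σ, and starting d s those
-- with first letter at least s; mod only serves to make s a letter.
members  : ∀ n (d s : ℕ) → List (Word n)
starting : ∀ n (d s : ℕ) → List (Word (suc n))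
members zero    d s       = [] ∷ []
members (suc n) d zero    = starting n d zero
members (suc n) d (suc s) = List.map (insert zero) (members n d s) ++ starting n d (suc s)
starting n zero    s = []
starting n (suc d) s = List.map (insert (s mod suc n)) (members n d s) ++ starting n d (suc s)

good-[] : ∀ {s} {σ : Word 0} → Good s σ
good-[] = ((λ {x} → λ { {()} }) , λ ()) , (λ { (() , _) }) , λ ()

toℕ-mod : ∀ {s n} → s < suc n → toℕ (s mod suc n) ≡ s
toℕ-mod {s} {n} s<n = trans (Fin.toℕ-fromℕ< (m%n<n s (suc n))) (m<n⇒m%n≡m s<n)

s<d+s : ∀ {n} d s → suc n ≡ suc d + s → s < suc n
s<d+s d s eq = subst (s <_) (sym eq) (s≤s (ℕ.m≤n+m s d))

shift-suc : ∀ {n} d s → suc n ≡ suc d + s → suc n ≡ d + suc s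
shift-suc d s eq = trans eq (sym (ℕ.+-suc d s))

members-sound  : ∀ n d s → n ≡ d + s → ∀ {σ} → σ ∈ members n d s → Good s σ
starting-sound : ∀ n d s → suc n ≡ d + s → ∀ {σ} → σ ∈ starting n d s →
  ∃[ v ] ∃[ τ ] (σ ≡ insert v τ × Good (toℕ v) τ × s ≤ toℕ v)
members-sound zero    d s       eq {σ} p = good-[] {σ = σ}
members-sound (suc n) d zero    eq p with starting-sound n d zero eq p
... | v , τ , refl , good , s≤v = decompose⁻ (large v good s≤v)
members-sound (suc n) d (suc s) eq p with ∈-++⁻ (List.map (insert zero) (members n d s)) p
... | inj₁ q with ∈-map⁻ (insert zero) q
...   | τ , τ∈ , refl = decompose⁻ (least refl
        (members-sound n d s (ℕ.suc-injective (trans eq (ℕ.+-suc d s))) τ∈))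
members-sound (suc n) d (suc s) eq p | inj₂ q with starting-sound n d (suc s) eq q
... | v , τ , refl , good , s≤v = decompose⁻ (large v good s≤v)
starting-sound n (suc d) s eq p with ∈-++⁻ (List.map (insert (s mod suc n)) (members n d s)) p
... | inj₁ q with ∈-map⁻ (insert (s mod suc n)) q
...   | τ , τ∈ , refl = s mod suc n , τ , refl ,
        subst (λ t → Good t τ) (sym v≡s) (members-sound n d s (ℕ.suc-injective eq) τ∈) ,
        ℕ.≤-reflexive (sym v≡s)
  where v≡s = toℕ-mod (s<d+s d s eq)
starting-sound n (suc d) s eq p | inj₂ q with starting-sound n d (suc s) (shift-suc d s eq) q
... | v , τ , e , good , s<v = v , τ , e , good , ℕ.<⇒≤ s<v

members-complete  : ∀ n d s → n ≡ d + s → ∀ {σ} → Good s σ → σ ∈ members n d s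
starting-complete : ∀ n d s → suc n ≡ d + s → ∀ v {τ} → Good (toℕ v) τ → s ≤ toℕ v →
  insert v τ ∈ starting n d s
members-complete zero    d s       eq {[]} good = here refl
members-complete (suc n) d zero    eq {σ} good with decompose {σ = σ} good
... | large v good′ s≤v = starting-complete n d zero eq v good′ s≤v
members-complete (suc n) d (suc s) eq {σ} good with decompose {σ = σ} good
... | large v good′ s≤v = ∈-++⁺ʳ _ (starting-complete n d (suc s) eq v good′ s≤v)
... | least refl good′  = ∈-++⁺ˡ (∈-map⁺ (insert zero)
        (members-complete n d s (ℕ.suc-injective (trans eq (ℕ.+-suc d s))) good′))
-- Here s = n + 1 exceeds every letter.
starting-complete n zero    s eq v good s≤v =
  contradiction (ℕ.<-≤-trans (Fin.toℕ<n v) (subst (_≤ toℕ v) (sym eq) s≤v)) (ℕ.<-irrefl refl)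
starting-complete n (suc d) s eq v {τ} good s≤v with s ℕ.≟ toℕ v
... | no  s≢v  = ∈-++⁺ʳ _ (starting-complete n d (suc s) (shift-suc d s eq) v good (ℕ.≤∧≢⇒< s≤v s≢v))
... | yes refl = ∈-++⁺ˡ (subst (λ u → insert v τ ∈ List.map (insert u) (members n d s))
        (sym (Fin.toℕ-injective (toℕ-mod (s<d+s d s eq))))
        (∈-map⁺ (insert v) (members-complete n d s (ℕ.suc-injective eq) good)))

-- Concatenated blocks are disjoint because their first letters differ: 0 against at least s + 1, or
-- s against larger letters.
members-unique  : ∀ n d s → n ≡ d + s → Unique (members n d s)
starting-unique : ∀ n d s → suc n ≡ d + s → Unique (starting n d s)
members-unique zero    d s       eq = All.[] AllPairs.∷ AllPairs.[]
members-unique (suc n) d zero    eq = starting-unique n d zero eq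
members-unique (suc n) d (suc s) eq = Unique.++⁺
  (Unique.map⁺ (insert-injectiveʳ zero)
    (members-unique n d s (ℕ.suc-injective (trans eq (ℕ.+-suc d s)))))
  (starting-unique n d (suc s) eq)
  disjoint′
  where
  disjoint′ : ∀ {σ} → ¬ (σ ∈ List.map (insert zero) (members n d s) × σ ∈ starting n d (suc s))
  disjoint′ (p , q) with ∈-map⁻ (insert zero) p | starting-sound n d (suc s) eq q
  ... | _ , _ , refl | v , τ , e , _ , s<v with () ← subst (λ u → suc s ≤ toℕ u) (sym (Vec.∷-injectiveˡ e)) s<v
starting-unique n zero    s eq = AllPairs.[]
starting-unique n (suc d) s eq = Unique.++⁺
  (Unique.map⁺ (insert-injectiveʳ (s mod suc n)) (members-unique n d s (ℕ.suc-injective eq)))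
  (starting-unique n d (suc s) (shift-suc d s eq))
  disjoint′
  where
  disjoint′ : ∀ {σ} → ¬ (σ ∈ List.map (insert (s mod suc n)) (members n d s) × σ ∈ starting n d (suc s))
  disjoint′ (p , q) with ∈-map⁻ (insert (s mod suc n)) p | starting-sound n d (suc s) (shift-suc d s eq) q
  ... | _ , _ , refl | v , τ , e , _ , s<v = ℕ.<-irrefl refl
    (subst (s <_) (trans (cong toℕ (sym (Vec.∷-injectiveˡ e))) (toℕ-mod (s<d+s d s eq))) s<v)

length-map-++ : ∀ {A B : Set} (f : A → B) xs ys →
  length (List.map f xs ++ ys) ≡ length xs + length ys
length-map-++ f xs ys =
  trans (List.length-++ (List.map f xs)) (cong (_+ length ys) (List.length-map f xs))

-- The lists obey the recursion of `ballot`: words with first letter at least s split into those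
-- starting with s and those starting higher, matching the two terms of `ballot (suc d) (suc s)`.
length-members  : ∀ n d s → n ≡ d + s → length (members n d s) ≡ ballot d s
length-starting : ∀ n d s → n ≡ d + s → length (starting n (suc d) s) ≡ ballot d (suc s)
length-members zero    zero    s       eq = refl
length-members (suc n) (suc d) zero    eq = length-starting n d zero (ℕ.suc-injective eq)
length-members (suc n) zero    (suc s) eq = trans
  (length-map-++ (insert zero) (members n zero s) [])
  (cong (_+ 0) (length-members n zero s (ℕ.suc-injective eq)))
length-members (suc n) (suc d) (suc s) eq = trans
  (length-map-++ (insert zero) (members n (suc d) s) _)
  (cong₂ _+_ (length-members n (suc d) s (trans (ℕ.suc-injective eq) (ℕ.+-suc d s)))
             (length-starting n d (suc s) (ℕ.suc-injective eq)))
length-starting n zero    s eq = trans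
  (length-map-++ (insert (s mod suc n)) (members n zero s) [])
  (cong (_+ 0) (length-members n zero s eq))
length-starting n (suc d) s eq = trans
  (length-map-++ (insert (s mod suc n)) (members n (suc d) s) _)
  (cong₂ _+_ (length-members n (suc d) s eq)
             (length-starting n d (suc s) (trans eq (sym (ℕ.+-suc d s)))))

unique-⊆⇒length≤ : ∀ {A : Set} {xs ys : List A} → Unique xs →
                   (∀ {x} → x ∈ xs → x ∈ ys) → length xs ≤ length ys
unique-⊆⇒length≤ {xs = []}     _ _ = z≤n
unique-⊆⇒length≤ {xs = x ∷ xs} (x∉xs AllPairs.∷ u) sub with ∈-∃++ (sub (here refl))
... | as , bs , refl = subst (suc (length xs) ≤_) (sym (↭-length (shift x as bs)))
  (s≤s (unique-⊆⇒length≤ u λ {y} y∈ → case-∈ y∈ (∈-resp-↭ (shift x as bs) (sub (there y∈)))))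
  where
  case-∈ : ∀ {y} → y ∈ xs → y ∈ x ∷ as ++ bs → y ∈ as ++ bs
  case-∈ y∈ (here refl) = contradiction refl (All.lookup x∉xs y∈)
  case-∈ y∈ (there p)   = p

-- Direct sums

-- A view rather than a plain sum: matching on it rewrites the index itself, so that the lookup laws
-- of direct sums apply.
data Split n m : Fin (n + m) → Set where
  left  : ∀ i → Split n m (i ↑ˡ m)
  right : ∀ j → Split n m (n ↑ʳ j)

split : ∀ n m i → Split n m i
split zero    m i       = right i
split (suc n) m zero    = left zero
split (suc n) m (suc i) with split n m i
... | left i′  = left (suc i′)
... | right j′ = right j′

module _ {n m : ℕ} where

  ↑ˡ-mono-< : {i j : Fin n} → i Fin.< j → (i ↑ˡ m) Fin.< (j ↑ˡ m)
  ↑ˡ-mono-< {i} {j} = subst₂ _<_ (sym (Fin.toℕ-↑ˡ i m)) (sym (Fin.toℕ-↑ˡ j m))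

  ↑ˡ-cancel-< : {i j : Fin n} → (i ↑ˡ m) Fin.< (j ↑ˡ m) → i Fin.< j
  ↑ˡ-cancel-< {i} {j} = subst₂ _<_ (Fin.toℕ-↑ˡ i m) (Fin.toℕ-↑ˡ j m)

  ↑ʳ-cancel-< : {i j : Fin m} → (n ↑ʳ i) Fin.< (n ↑ʳ j) → i Fin.< j
  ↑ʳ-cancel-< {i} {j} p =
    ℕ.+-cancelˡ-< n _ _ (subst₂ _<_ (Fin.toℕ-↑ʳ n i) (Fin.toℕ-↑ʳ n j) p)

  ↑ˡ<↑ʳ : ∀ (i : Fin n) (j : Fin m) → (i ↑ˡ m) Fin.< (n ↑ʳ j)
  ↑ˡ<↑ʳ i j = subst₂ _<_ (sym (Fin.toℕ-↑ˡ i m)) (sym (Fin.toℕ-↑ʳ n j))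
    (ℕ.<-≤-trans (Fin.toℕ<n i) (ℕ.m≤m+n n _))

-- Excludes edges from the right block of a direct sum back into the left one.
child⇒< : ∀ {k l} {i j : Fin l} → 1 ≤ k → Child k i j → i Fin.< j
child⇒< {k} {l} {i} {j} 1≤k (p , _) = begin-strict
  toℕ i              <⟨ ℕ.n<1+n (toℕ i) ⟩
  1 + toℕ i          ≡⟨ ℕ.+-comm 1 (toℕ i) ⟩
  toℕ i + 1          ≡⟨ cong (_+ 1) (ℕ.*-identityˡ (toℕ i)) ⟨
  1 * toℕ i + 1      ≤⟨ ℕ.+-monoˡ-≤ 1 (ℕ.*-monoˡ-≤ (toℕ i) 1≤k) ⟩
  k * toℕ i + 1      ≤⟨ ℕ.s≤s⁻¹ (subst (_≤ pos j) (ℕ.+-suc (k * toℕ i) 1) p) ⟩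
  toℕ j              ∎
  where open ℕ.≤-Reasoning

-- The children of vertex n + 1 start at position kn + 2 > n + m.
no-child-right : ∀ {n m k} (i j : Fin m) → 2 ≤ k → m ≤ suc n → ¬ Child k (n ↑ʳ i) (n ↑ʳ j)
no-child-right {n} {m} {k} i j 2≤k m≤1+n (p , _) = ℕ.<-irrefl refl (begin-strict
  k * toℕ (n ↑ʳ i) + 2     ≤⟨ p ⟩
  suc (toℕ (n ↑ʳ j))       ≤⟨ Fin.toℕ<n (n ↑ʳ j) ⟩
  n + m                    ≤⟨ ℕ.+-monoʳ-≤ n m≤1+n ⟩
  n + suc n                <⟨ ℕ.≤-reflexive (cong suc (ℕ.+-suc n n)) ⟩
  2 + (n + n)              ≡⟨ ℕ.+-comm 2 (n + n) ⟩
  n + n + 2                ≡⟨ cong (λ x → n + x + 2) (ℕ.+-identityʳ n) ⟨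
  2 * n + 2                ≤⟨ ℕ.+-monoˡ-≤ 2 (ℕ.*-mono-≤ 2≤k
                                (subst (n ≤_) (sym (Fin.toℕ-↑ʳ n i)) (ℕ.m≤m+n n (toℕ i)))) ⟩
  k * toℕ (n ↑ʳ i) + 2     ∎)
  where open ℕ.≤-Reasoning

infixr 5 _⊕_
_⊕_ : ∀ {n m} → Word n → Word m → Word (n + m)
_⊕_ {n} {m} σ τ = Vec.map (_↑ˡ m) σ Vec.++ Vec.map (n ↑ʳ_) τ

⊕-injective : ∀ {n m} {σ σ′ : Word n} {τ τ′ : Word m} → σ ⊕ τ ≡ σ′ ⊕ τ′ → σ ≡ σ′ × τ ≡ τ′
⊕-injective {n} {m} eq =
  map-injective (λ {x} {y} → Fin.↑ˡ-injective m x y) (Vec.++-injectiveˡ _ _ eq) ,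
  map-injective (λ {x} {y} → Fin.↑ʳ-injective n x y) (Vec.++-injectiveʳ _ _ eq)

module _ {n m : ℕ} (σ : Word n) (τ : Word m) where

  lookup-⊕ˡ : ∀ i → lookup (σ ⊕ τ) (i ↑ˡ m) ≡ lookup σ i ↑ˡ m
  lookup-⊕ˡ i = trans (Vec.lookup-++ˡ (Vec.map (_↑ˡ m) σ) _ i) (Vec.lookup-map i (_↑ˡ m) σ)

  lookup-⊕ʳ : ∀ j → lookup (σ ⊕ τ) (n ↑ʳ j) ≡ n ↑ʳ lookup τ j
  lookup-⊕ʳ j = trans (Vec.lookup-++ʳ (Vec.map (_↑ˡ m) σ) _ j) (Vec.lookup-map j (n ↑ʳ_) τ)

  ⊕-left<right : ∀ i j → lookup (σ ⊕ τ) (i ↑ˡ m) Fin.< lookup (σ ⊕ τ) (n ↑ʳ j)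
  ⊕-left<right i j =
    subst₂ Fin._<_ (sym (lookup-⊕ˡ i)) (sym (lookup-⊕ʳ j)) (↑ˡ<↑ʳ (lookup σ i) (lookup τ j))

  ⊕-cancelˡ-< : ∀ {i j} → lookup (σ ⊕ τ) (i ↑ˡ m) Fin.< lookup (σ ⊕ τ) (j ↑ˡ m) →
                lookup σ i Fin.< lookup σ j
  ⊕-cancelˡ-< {i} {j} p = ↑ˡ-cancel-< (subst₂ Fin._<_ (lookup-⊕ˡ i) (lookup-⊕ˡ j) p)

  ⊕-cancelʳ-< : ∀ {i j} → lookup (σ ⊕ τ) (n ↑ʳ i) Fin.< lookup (σ ⊕ τ) (n ↑ʳ j) →
                lookup τ i Fin.< lookup τ j
  ⊕-cancelʳ-< {i} {j} p =
    ↑ʳ-cancel-< {n = n} (subst₂ Fin._<_ (lookup-⊕ʳ i) (lookup-⊕ʳ j) p)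

  ⊕-permutation : IsPermutation σ → IsPermutation τ → IsPermutation (σ ⊕ τ)
  ⊕-permutation (injσ , surσ) (injτ , surτ) = inj , sur
    where
    inj : Injective _≡_ _≡_ (lookup (σ ⊕ τ))
    inj {x} {y} e with split n m x | split n m y
    ... | left i  | left j  = cong (_↑ˡ m) (injσ (Fin.↑ˡ-injective m _ _
            (trans (sym (lookup-⊕ˡ i)) (trans e (lookup-⊕ˡ j)))))
    ... | left i  | right j = contradiction (cong toℕ e) (ℕ.<⇒≢ (⊕-left<right i j))
    ... | right i | left j  = contradiction (cong toℕ (sym e)) (ℕ.<⇒≢ (⊕-left<right j i))
    ... | right i | right j = cong (n ↑ʳ_) (injτ (Fin.↑ʳ-injective n _ _
            (trans (sym (lookup-⊕ʳ i)) (trans e (lookup-⊕ʳ j)))))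
    sur : Surjective _≡_ _≡_ (lookup (σ ⊕ τ))
    sur y with split n m y
    ... | left i  = let (x , h) = surσ i in
            x ↑ˡ m , λ { refl → trans (lookup-⊕ˡ x) (cong (_↑ˡ m) (h refl)) }
    ... | right j = let (x , h) = surτ j in
            n ↑ʳ x , λ { refl → trans (lookup-⊕ʳ x) (cong (n ↑ʳ_) (h refl)) }

  -- Positions and letters of the left block all lie below those of the right, so a decreasing
  -- pattern cannot meet both blocks.
  ⊕-avoids : Avoids321 σ → Avoids321 τ → Avoids321 (σ ⊕ τ)
  ⊕-avoids avσ avτ (a , b , c , a<b , b<c , ba , cb)
    with split n m a | split n m b | split n m c
  ... | left a′  | left b′  | left c′  = avσ (a′ , b′ , c′ ,
          ↑ˡ-cancel-< a<b , ↑ˡ-cancel-< b<c , ⊕-cancelˡ-< ba , ⊕-cancelˡ-< cb)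
  ... | right a′ | right b′ | right c′ = avτ (a′ , b′ , c′ ,
          ↑ʳ-cancel-< {n = n} a<b , ↑ʳ-cancel-< {n = n} b<c , ⊕-cancelʳ-< ba , ⊕-cancelʳ-< cb)
  ... | left a′  | right b′ | _        = ℕ.<-asym ba (⊕-left<right a′ b′)
  ... | _        | left b′  | right c′ = ℕ.<-asym cb (⊕-left<right b′ c′)
  ... | right a′ | left b′  | _        = ℕ.<-asym a<b (↑ˡ<↑ʳ b′ a′)
  ... | _        | right b′ | left c′  = ℕ.<-asym b<c (↑ˡ<↑ʳ c′ b′)


  -- Edges inside the left block are handled by σ, edges from left to right increase automatically,
  -- and no edge starts in the right block.
  ⊕-heap : ∀ {k} → 2 ≤ k → m ≤ suc n → IsHeap k σ → IsPermutation τ → IsHeap k (σ ⊕ τ)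
  ⊕-heap {k} 2≤k m≤1+n (permσ , heapσ) permτ = ⊕-permutation permσ permτ , heap
    where
    heap : ∀ x y → Child k x y → lookup (σ ⊕ τ) x Fin.< lookup (σ ⊕ τ) y
    heap x y ch with split n m x | split n m y
    -- `Child` depends only on numerical positions, which `↑ˡ` preserves.
    ... | left i  | left j  = subst₂ Fin._<_ (sym (lookup-⊕ˡ i)) (sym (lookup-⊕ˡ j))
            (↑ˡ-mono-< (heapσ i j (subst₂
              (λ u v → (k * u + 2 ≤ suc v) × (suc v ≤ k * suc u + 1))
              (Fin.toℕ-↑ˡ i m) (Fin.toℕ-↑ˡ j m) ch)))
    ... | left i  | right j = ⊕-left<right i j
    ... | right i | left j  = contradiction (↑ˡ<↑ʳ j i)
            (ℕ.<-asym (child⇒< {i = n ↑ʳ i} {j ↑ˡ m} (ℕ.≤-trans (s≤s z≤n) 2≤k) ch))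
    ... | right i | right j = contradiction ch (no-child-right i j 2≤k m≤1+n)

-- Bounds for the number of heaps

avoiders : ∀ n → List (Word n)
avoiders n = members n n 0

length-avoiders : ∀ n → length (avoiders n) ≡ catalan n
length-avoiders n = length-members n n 0 (sym (ℕ.+-identityʳ n))

heaps : ∀ k n → List (Word n)
heaps k n = filter (isHeap321? k) (allVecs n n)

∈-heaps⁺ : ∀ k {n} {σ : Word n} → IsHeap321 k σ → σ ∈ heaps k n
∈-heaps⁺ k {n} {σ} h = ∈-filter⁺ (isHeap321? k) (∈-allVecs σ) h

∈-heaps⁻ : ∀ k {n} {σ : Word n} → σ ∈ heaps k n → IsHeap321 k σ
∈-heaps⁻ k {n} p = proj₂ (∈-filter⁻ (isHeap321? k) {xs = allVecs n n} p)

heaps-unique : ∀ k n → Unique (heaps k n)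
heaps-unique k n = Unique.filter⁺ (isHeap321? k) (allVecs-unique n n)

-- Heaps are compared with all 321-avoiders of the same length, of which there are `catalan n`.
∣𝓗321∣≤4^ : ∀ k n → ∣𝓗321∣ k n ≤ 4 ℕ.^ n
∣𝓗321∣≤4^ k n = ℕ.≤-trans
  (subst (∣𝓗321∣ k n ≤_) (length-avoiders n)
    (unique-⊆⇒length≤ (heaps-unique k n) λ p →
      let ((perm , _) , av) = ∈-heaps⁻ k p
      in members-complete n n 0 (sym (ℕ.+-identityʳ n)) (perm , av , λ _ _ _ ())))
  (catalan-≤ n)

1≤∣𝓗321∣-0 : ∀ k → 1 ≤ ∣𝓗321∣ k 0
1≤∣𝓗321∣-0 k = unique-⊆⇒length≤ (members-unique 0 0 0 refl) λ { {Vec.[]} _ →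
  let (perm , av , _) = good-[] {0} {Vec.[]} in ∈-heaps⁺ k ((perm , λ ()) , av) }

-- For fixed block lengths `_⊕_` is injective, so pairs of a heap and a 321-avoider yield distinct
-- heaps.
∣𝓗321∣-super : ∀ {k} → 2 ≤ k → ∀ {n m} → m ≤ suc n → ∣𝓗321∣ k n * catalan m ≤ ∣𝓗321∣ k (n + m)
∣𝓗321∣-super {k} 2≤k {n} {m} m≤1+n = subst (_≤ ∣𝓗321∣ k (n + m))
  (trans (length-cartesianProductWith (heaps k n) (avoiders m))
    (cong (∣𝓗321∣ k n *_) (length-avoiders m)))
  (unique-⊆⇒length≤
    (Unique.cartesianProductWith⁺ _⊕_ ⊕-injective (heaps-unique k n)
      (members-unique m m 0 (sym (ℕ.+-identityʳ m))))
    sums-are-heaps)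
  where
  length-cartesianProductWith : ∀ xs ys →
    length (cartesianProductWith (_⊕_ {n} {m}) xs ys) ≡ length xs * length ys
  length-cartesianProductWith []       ys = refl
  length-cartesianProductWith (x ∷ xs) ys = trans (length-map-++ (x ⊕_) ys _)
    (cong (length ys +_) (length-cartesianProductWith xs ys))
  sums-are-heaps : ∀ {ρ} → ρ ∈ cartesianProductWith _⊕_ (heaps k n) (avoiders m) → ρ ∈ heaps k (n + m)
  sums-are-heaps p with ∈-cartesianProductWith⁻ _⊕_ (heaps k n) (avoiders m) p
  ... | σ , τ , σ∈ , τ∈ , refl =
    let (heapσ , avσ)        = ∈-heaps⁻ k σ∈
        (permτ , avτ , _)    = members-sound m m 0 (sym (ℕ.+-identityʳ m)) τ∈
    in ∈-heaps⁺ k (⊕-heap σ τ 2≤k m≤1+n heapσ permτ , ⊕-avoids σ τ avσ avτ)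

-- Passage to real roots

-- The division in `fromℕ a` involves a gcd that does not compute for variable `a`; this is the same
-- rational given in lowest terms, on which arithmetic reduces.
integral : ℕ → ℚ
integral a = mkℚ (ℤ.+ a) 0 (Coprime.sym (1-coprimeTo a))

fromℕ≡integral : ∀ a → fromℕ a ≡ integral a
fromℕ≡integral a = ℚ.normalize-coprime (Coprime.sym (1-coprimeTo a))

fromℕ-* : ∀ a b → fromℕ (a * b) ≡ fromℕ a ℚ.* fromℕ b
fromℕ-* a b = trans (cong (ℚ._/ 1) (ℤ.pos-* a b))
  (sym (cong₂ ℚ._*_ (fromℕ≡integral a) (fromℕ≡integral b)))

fromℕ-suc : ∀ a → fromℕ (suc a) ≡ 1ℚ ℚ.+ fromℕ a
fromℕ-suc a = trans
  (cong (λ x → (ℤ.+ 1 ℤ.+ x) ℚ./ 1) (sym (ℤ.*-identityʳ (ℤ.+ a))))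
  (cong (1ℚ ℚ.+_) (sym (fromℕ≡integral a)))

fromℕ-mono-< : ∀ {a b} → a < b → fromℕ a ℚ.< fromℕ b
fromℕ-mono-< {a} {b} a<b = subst₂ ℚ._<_ (sym (fromℕ≡integral a)) (sym (fromℕ≡integral b))
  (ℚ.*<* (subst₂ ℤ._<_ (sym (ℤ.*-identityʳ (ℤ.+ a))) (sym (ℤ.*-identityʳ (ℤ.+ b))) (ℤ.+<+ a<b)))

fromℕ-mono-≤ : ∀ {a b} → a ≤ b → fromℕ a ℚ.≤ fromℕ b
fromℕ-mono-≤ {a} {b} a≤b = subst₂ ℚ._≤_ (sym (fromℕ≡integral a)) (sym (fromℕ≡integral b))
  (ℚ.*≤* (subst₂ ℤ._≤_ (sym (ℤ.*-identityʳ (ℤ.+ a))) (sym (ℤ.*-identityʳ (ℤ.+ b))) (ℤ.+≤+ a≤b)))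

fromℕ-^ : ∀ a n → fromℕ (a ^ n) ≡ fromℕ a ^ℚ n
fromℕ-^ a zero    = refl
fromℕ-^ a (suc n) = trans (fromℕ-* a (a ^ n)) (cong (fromℕ a ℚ.*_) (fromℕ-^ a n))

^-positive : ∀ {x} → 0ℚ ℚ.< x → ∀ n → 0ℚ ℚ.< x ^ℚ n
^-positive         0<x zero    = ℚ.positive⁻¹ 1ℚ
^-positive {x = x} 0<x (suc n) = subst (ℚ._< x ℚ.* x ^ℚ n) (ℚ.*-zeroʳ x)
  (ℚ.*-monoʳ-<-pos x {{ℚ.positive 0<x}} (^-positive 0<x n))

^-mono-< : ∀ {x y} n .{{_ : NonZero n}} → 0ℚ ℚ.< x → x ℚ.< y → x ^ℚ n ℚ.< y ^ℚ n
^-mono-< {x} {y} (suc zero)    0<x x<y =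
  subst₂ ℚ._<_ (sym (ℚ.*-identityʳ x)) (sym (ℚ.*-identityʳ y)) x<y
^-mono-< {x} {y} (suc (suc n)) 0<x x<y = ℚ.<-trans
  (ℚ.*-monoʳ-<-pos x {{ℚ.positive 0<x}} (^-mono-< (suc n) 0<x x<y))
  (ℚ.*-monoˡ-<-pos (y ^ℚ suc n) {{ℚ.positive (^-positive (ℚ.<-trans 0<x x<y) (suc n))}} x<y)

reciprocal-below : ∀ ε → 0ℚ ℚ.< ε →
  ∃[ D ] ∃[ δ ] (δ ℚ.< ε × δ ℚ.* fromℕ (suc D) ≡ 1ℚ)
reciprocal-below (mkℚ (ℤ.+ zero)  q c) (ℚ.*<* (ℤ.+<+ ()))
reciprocal-below (mkℚ ℤ.-[1+ _ ]  q c) (ℚ.*<* ())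
-- `q` is the denominator minus one, so ε ≥ 1/(q+1) > 1/(q+2); the returned natural is likewise one
-- less than the denominator of δ.
reciprocal-below (mkℚ ℤ.+[1+ p ]  q c) _ = suc q , ℚ.1/ integral (suc (suc q)) ,
  ℚ.*<* (ℤ.+<+ (ℕ.≤-trans (s≤s (s≤s (ℕ.≤-reflexive (ℕ.+-identityʳ q)))) (ℕ.m≤m+n (suc (suc q)) _))) ,
  trans (cong (ℚ.1/ integral (suc (suc q)) ℚ.*_) (fromℕ≡integral (suc (suc q))))
    (ℚ.*-inverseˡ (integral (suc (suc q))))

root-≤-4 : ∀ {ε} → 0ℚ ℚ.< ε → ∀ n .{{_ : NonZero n}} {a} → a ≤ 4 ^ n →
           LessUpTo ε (root n a) (fromℚ (fromℕ 4))
root-≤-4 {ε} 0<ε n {a} a≤4^n =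
  -- A point strictly above 4 is taken because the upper cut of the root is open, while `a` is only
  -- bounded weakly by 4^n.
  let (q , 4<q , q<4+ε) = ℚ.<-dense 4<4+ε
  in q ,
     (ℚ.<-trans (ℚ.positive⁻¹ (fromℕ 4)) 4<q ,
      ℚ.≤-<-trans (subst (fromℕ a ℚ.≤_) (fromℕ-^ 4 n) (fromℕ-mono-≤ a≤4^n))
        (^-mono-< n (ℚ.positive⁻¹ (fromℕ 4)) 4<q)) ,
     subst (q ℚ.- ε ℚ.<_) (solve 2 (λ f e → f :+ e :- e := f) refl (fromℕ 4) ε)
       (ℚ.+-monoˡ-< (ℚ.- ε) q<4+ε)
  where
  open +-*-Solver
  4<4+ε : fromℕ 4 ℚ.< fromℕ 4 ℚ.+ ε
  4<4+ε = subst (ℚ._< fromℕ 4 ℚ.+ ε) (ℚ.+-identityʳ (fromℕ 4)) (ℚ.+-monoʳ-< (fromℕ 4) 0<ε)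

-- The witness is q = x + ε with x = 4 − δ = a / D.
4-≤-root : ∀ {ε δ D a b} n .{{_ : NonZero n}} → δ ℚ.< ε → δ ℚ.* fromℕ D ≡ 1ℚ →
           suc a ≡ 4 * D → a ^ n < D ^ n * b →
           LessUpTo ε (fromℚ (fromℕ 4)) (root n b)
4-≤-root {ε} {δ} {D} {a} {b} n δ<ε δD≡1 1+a≡4D a^n<D^n*b =
  x ℚ.+ ε ,
  subst (ℚ._< x ℚ.+ ε) (solve 2 (λ f d → f :- d :+ d := f) refl (fromℕ 4) δ) (ℚ.+-monoʳ-< x δ<ε) ,
  inj₂ (subst (λ y → y ^ℚ n ℚ.< fromℕ b)
    (solve 2 (λ y e → y := y :+ e :- e) refl x ε) x^n<b)
  where
  open +-*-Solver
  x = fromℕ 4 ℚ.- δ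
  instance
    D^n-nonNeg : ℚ.NonNegative (fromℕ D ^ℚ n)
    D^n-nonNeg = subst ℚ.NonNegative (fromℕ-^ D n) (ℚ.normalize-nonNeg (D ^ n) 1)
  xD≡a : x ℚ.* fromℕ D ≡ fromℕ a
  xD≡a = begin
    (fromℕ 4 ℚ.- δ) ℚ.* fromℕ D              ≡⟨ solve 3 (λ f d D → (f :- d) :* D := f :* D :- d :* D) refl (fromℕ 4) δ (fromℕ D) ⟩
    fromℕ 4 ℚ.* fromℕ D ℚ.- δ ℚ.* fromℕ D    ≡⟨ cong₂ ℚ._-_ (trans (sym (fromℕ-* 4 D)) (trans (cong fromℕ (sym 1+a≡4D)) (fromℕ-suc a))) δD≡1 ⟩
    1ℚ ℚ.+ fromℕ a ℚ.- 1ℚ                    ≡⟨ solve 1 (λ a → con 1ℚ :+ a :- con 1ℚ := a) refl (fromℕ a) ⟩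
    fromℕ a                                  ∎
    where open ≡-Reasoning
  x^n<b : x ^ℚ n ℚ.< fromℕ b
  -- Since xD = a, multiplying by D^n reduces the claim to the integer inequality a^n < D^n b.
  x^n<b = ℚ.*-cancelʳ-<-nonNeg (fromℕ D ^ℚ n) (begin-strict
    x ^ℚ n ℚ.* fromℕ D ^ℚ n                    ≡⟨ ^-distrib-* x (fromℕ D) n ⟨
    (x ℚ.* fromℕ D) ^ℚ n                      ≡⟨ cong (_^ℚ n) xD≡a ⟩
    fromℕ a ^ℚ n                              ≡⟨ fromℕ-^ a n ⟨
    fromℕ (a ^ n)                          <⟨ fromℕ-mono-< a^n<D^n*b ⟩
    fromℕ (D ^ n * b)                    ≡⟨ fromℕ-* (D ^ n) b ⟩
    fromℕ (D ^ n) ℚ.* fromℕ b              ≡⟨ cong (ℚ._* fromℕ b) (fromℕ-^ D n) ⟩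
    fromℕ D ^ℚ n ℚ.* fromℕ b                  ≡⟨ ℚ.*-comm (fromℕ D ^ℚ n) (fromℕ b) ⟩
    fromℕ b ℚ.* fromℕ D ^ℚ n                  ∎)
    where open ℚ.≤-Reasoning

corollary2p1 : (k : ℕ) → 2 ≤ k →
    (λ n → root n (∣𝓗321∣ k n)) ⟶ fromℚ (fromℕ 4)
corollary2p1 k 2≤k ε 0<ε =
  let (D-1 , δ , δ<ε , δD≡1) = reciprocal-below ε 0<ε
      -- With D = `suc D-1`, this is a = 4D - 1, so a/D = 4 - δ for δ = 1/D; with `pred` the
      -- equation `suc a ≡ 4 * D` holds by `refl`.
      a = ℕ.pred (4 * suc D-1)
      (N , a^n<) = growth (∣𝓗321∣ k) (1≤∣𝓗321∣-0 k) (∣𝓗321∣-super 2≤k) a (suc D-1)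
        {{ℕ.>-nonZero (ℕ.m≤n⇒m≤o+n D-1 (s≤s z≤n))}} refl
  in N , λ n N≤n →
    root-≤-4 0<ε n (∣𝓗321∣≤4^ k n) ,
    4-≤-root n δ<ε δD≡1 refl (a^n< n N≤n)
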